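{- Let $p_1(n)$ denote the number of partitions of $n$ into parts congruent to $\pm 1, \pm 5, \pm 11, \pm 12 \pmod{30}$, where the parts congruent to $\pm 5, \pm 12 \pmod{30}$ have two colors. Let $p_2(n)$ denote the number of partitions of $n$ into parts congruent to $\pm 5, \pm 6, \pm 7, \pm 13 \pmod{30}$, where the parts congruent to $\pm 5, \pm 6 \pmod{30}$ have two colors. Let $p_3(n)$ denote the number of partitions of $n$ into parts congruent to $\pm 1, \pm 6, \pm 7, \pm 11, \pm 12, \pm 13 \pmod{30}$. Then for each positive integer $n$, \[ p_1(n)-p_2(n)=p_3(n-1). \]
   Context: A partition in which parts from certain residue classes "have two colors" means each such part size may appear in two distinguishable copies (colors), so the generating function for parts $\equiv r \pmod{s}$ with $k$ colors is $\prod_{m\ge0}(1-q^{sm+r})^{ -k}$. Here $\pm r \pmod{30}$ means the classes $r$ and $30-r$ modulo $30$; parts are positive integers. By convention $p_i(0)=1$. -}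

module Defs where

open import Data.Nat using (ℕ; zero; suc; _+_; _*_; _∸_; _%_; _≤ᵇ_)
open import Data.Nat.Properties using (_≟_)
open import Data.Nat.ListAction using (sum)
open import Data.List using (List; []; _∷_; map; upTo; concatMap; replicate)
open import Data.Bool using (if_then_else_)
open import Relation.Nullary.Decidable using (⌊_⌋)

-- Number of ways to write n as  Σ_j k_j * t_j  (k_j ≥ 0), where the list
-- ts = t_1, t_2, ... lists the available "part types" (each type is a part
-- size; a size occurring c times in the list is a part with c colours).
-- Its generating function is  Π_j (1 - q^{t_j})^{-1}  (for positive t_j).
countReps : ℕ → List ℕ → ℕ
countReps n [] = if ⌊ n ≟ 0 ⌋ then 1 else 0
countReps n (t ∷ ts) =
  sum (map (λ k → if k * t ≤ᵇ n then countReps (n ∸ k * t) ts else 0) (upTo (suc n)))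

partTypes : (ℕ → ℕ) → ℕ → List ℕ
partTypes colours n = concatMap (λ s → replicate (colours s) s) (map suc (upTo n))

colouredPartitions : (ℕ → ℕ) → ℕ → ℕ
colouredPartitions colours n = countReps n (partTypes colours n)

_≡±_mod30 : ℕ → ℕ → Data.Bool.Bool
s ≡± r mod30 = ⌊ s % 30 ≟ r ⌋ Data.Bool.∨ ⌊ s % 30 ≟ 30 ∸ r ⌋

colours₁ : ℕ → ℕ
colours₁ s =
  if (s ≡± 5 mod30) Data.Bool.∨ (s ≡± 12 mod30) then 2
  else if (s ≡± 1 mod30) Data.Bool.∨ (s ≡± 11 mod30) then 1 else 0

colours₂ : ℕ → ℕ
colours₂ s =
  if (s ≡± 5 mod30) Data.Bool.∨ (s ≡± 6 mod30) then 2
  else if (s ≡± 7 mod30) Data.Bool.∨ (s ≡± 13 mod30) then 1 else 0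

colours₃ : ℕ → ℕ
colours₃ s =
  if (s ≡± 1 mod30) Data.Bool.∨ (s ≡± 6 mod30) Data.Bool.∨ (s ≡± 7 mod30)
     Data.Bool.∨ (s ≡± 11 mod30) Data.Bool.∨ (s ≡± 12 mod30) Data.Bool.∨ (s ≡± 13 mod30)
  then 1 else 0

p₁ p₂ p₃ : ℕ → ℕ
p₁ = colouredPartitions colours₁
p₂ = colouredPartitions colours₂
p₃ = colouredPartitions colours₃

{-# OPTIONS --safe #-}
-- Write [r] = (q^r; q^30)_∞ (q^(30−r); q^30)_∞.  Clearing denominators turns the claim into
--   [6]² [7] [13] = [1] [11] [12]² + q [5]² [6] [12],
-- a case of Weierstrass' three-term relation.  By the Jacobi triple product, [r] is, up to a factor
-- that does not depend on r, the theta series f(−q^r, −q^(30−r)), where f(A,B) = Σ A^(n(n+1)/2) B^(n(n−1)/2).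
-- Splitting a product of two such double series according to the parity of m + n writes it as a 2 × 2
-- minor in the values f(q^s, q^(60−s)), and the three-term relation becomes a Plücker relation.
-- Everything takes place modulo q^K, where q is nilpotent, so that all bilateral series are finite sums;
-- working in commutative semirings with an element ε such that 1 + ε ≈ 0 avoids subtraction.
module Submission where

open import Defs
open import Data.Nat as ℕ using (ℕ; zero; suc; _≤_; _∸_)
import Data.Nat.Properties as ℕ
open import Data.Nat.DivMod using ([m+kn]%n≡m%n)
open import Data.Nat.ListAction using (sum)
open import Data.Bool using (true; false; if_then_else_; _∨_; T)
open import Data.Integer as ℤ using (ℤ; +_; -[1+_]; ∣_∣; 0ℤ; 1ℤ; -1ℤ; _-_)
import Data.Integer.Properties as ℤ
open import Data.Integer.Tactic.RingSolver using (solve-∀)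
open import Data.List using (List; []; _∷_; map; upTo; applyUpTo; replicate; _++_; concatMap; foldr; _∷ʳ_)
import Data.List.Properties as List
open import Data.List.Relation.Unary.All using (All; []; _∷_)
import Data.List.Relation.Unary.All.Properties as All
open import Data.Product using (∃-syntax; _,_)
open import Function using (_∘_)
open import Level using (0ℓ)
open import Relation.Binary.Structures using (IsEquivalence)
open import Relation.Nullary using (yes; no)
open import Relation.Nullary.Decidable using (⌊_⌋)
open import Relation.Binary.PropositionalEquality as ≡ using (_≡_)
open import Algebra.Bundles using (CommutativeSemiring)
open import Algebra.Structures.Biased using (isCommutativeSemiringˡ)

-- Bilateral sums

-- Write h_s = f(q^s, q^(60-s)), so that h_s = h_(60-s). Splitting [r][s] by parity gives, up to a
-- common factor, h_(r+s) h_(30+r-s) - q^r h_(30+r+s) h_(60+r-s). Up to sign modulo 30, the indices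
-- that occur for [6][13], [6][7], [11][12], [1][12], [5][6] and [5][12] run exactly once through
-- the six pairs from 13, 19, 23, 29. Hence these six products can be the minors of a single 2 × 4
-- matrix, and multiplying complementary minors restores the three terms of the relation. Nilpotency
-- removes all questions of convergence, but it has a price: every change of summation index moves
-- the finite window, and the move is legitimate only if the terms gained or lost are zero. Sums
-- therefore come with a bound K on the support and a window that may be any larger one. Nothing is
-- divided at the end either: the generating functions are themselves the inverses of the products,
-- and multiplying by them undoes the clearing of denominators.

tri : ℕ → ℕ
tri zero = 0
tri (suc n) = suc n ℕ.+ tri n

-- t i = i (i + 1) / 2, for negative i as well.
t : ℤ → ℕ
t (+ n) = tri n
t -[1+ n ] = tri n

private
  double-tri : ∀ n → + 2 ℤ.* + tri n ≡ + n ℤ.* (+ n ℤ.+ 1ℤ)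
  double-tri zero = ≡.refl
  double-tri (suc n) = ≡.trans (lemma₁ (+ n) (+ tri n))
    (≡.trans (≡.cong (ℤ._+ (+ 2 ℤ.+ + 2 ℤ.* + n)) (double-tri n)) (lemma₂ (+ n)))
    where
    lemma₁ : ∀ n u → + 2 ℤ.* ((1ℤ ℤ.+ n) ℤ.+ u) ≡ + 2 ℤ.* u ℤ.+ (+ 2 ℤ.+ + 2 ℤ.* n)
    lemma₁ = solve-∀
    lemma₂ : ∀ n → n ℤ.* (n ℤ.+ 1ℤ) ℤ.+ (+ 2 ℤ.+ + 2 ℤ.* n) ≡ (1ℤ ℤ.+ n) ℤ.* ((1ℤ ℤ.+ n) ℤ.+ 1ℤ)
    lemma₂ = solve-∀

  double-t : ∀ i → + 2 ℤ.* + t i ≡ i ℤ.* (i ℤ.+ 1ℤ)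
  double-t (+ n) = double-tri n
  double-t -[1+ n ] = ≡.trans (double-tri n) (lemma (+ n))
    where
    lemma : ∀ n → n ℤ.* (n ℤ.+ 1ℤ) ≡ (ℤ.- (1ℤ ℤ.+ n)) ℤ.* ((ℤ.- (1ℤ ℤ.+ n)) ℤ.+ 1ℤ)
    lemma = solve-∀

-- Since `t` is quadratic, its failure to be additive is the bilinear term. Both sides are doubled,
-- where `t` becomes a polynomial and the ring solver applies. Together with `t-neg` this is all
-- that later exponent comparisons know about `t`.
t-+ : ∀ i j → + t (i ℤ.+ j) ≡ + t i ℤ.+ + t j ℤ.+ i ℤ.* j
t-+ i j = ℤ.*-cancelˡ-≡ (+ 2) _ _ (≡.trans (double-t (i ℤ.+ j)) (≡.trans (lemma₁ i j)
    (≡.trans (≡.cong₂ (λ x y → x ℤ.+ y ℤ.+ + 2 ℤ.* (i ℤ.* j)) (≡.sym (double-t i)) (≡.sym (double-t j)))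
      (lemma₂ (+ t i) (+ t j) (i ℤ.* j)))))
  where
  lemma₁ : ∀ i j → (i ℤ.+ j) ℤ.* ((i ℤ.+ j) ℤ.+ 1ℤ) ≡ i ℤ.* (i ℤ.+ 1ℤ) ℤ.+ j ℤ.* (j ℤ.+ 1ℤ) ℤ.+ + 2 ℤ.* (i ℤ.* j)
  lemma₁ = solve-∀
  lemma₂ : ∀ x y z → + 2 ℤ.* x ℤ.+ + 2 ℤ.* y ℤ.+ + 2 ℤ.* z ≡ + 2 ℤ.* (x ℤ.+ y ℤ.+ z)
  lemma₂ = solve-∀

t-neg : ∀ i → + t (ℤ.- i) ≡ + t i ℤ.- i
t-neg i = ℤ.*-cancelˡ-≡ (+ 2) _ _ (≡.trans (double-t (ℤ.- i)) (≡.trans (lemma₁ i)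
    (≡.trans (≡.cong (λ x → x ℤ.- + 2 ℤ.* i) (≡.sym (double-t i))) (lemma₂ (+ t i) i))))
  where
  lemma₁ : ∀ i → (ℤ.- i) ℤ.* ((ℤ.- i) ℤ.+ 1ℤ) ≡ i ℤ.* (i ℤ.+ 1ℤ) ℤ.- + 2 ℤ.* i
  lemma₁ = solve-∀
  lemma₂ : ∀ x y → + 2 ℤ.* x ℤ.- + 2 ℤ.* y ≡ + 2 ℤ.* (x ℤ.- y)
  lemma₂ = solve-∀

n≤tri : ∀ n → n ℕ.≤ tri n
n≤tri zero = ℕ.z≤n
n≤tri (suc n) = ℕ.m≤m+n (suc n) (tri n)

private
  difference : ∀ {i j} → i ℤ.≤ j → ∃[ x ] i ℤ.+ + x ≡ j
  difference {i} {j} i≤j = ∣ i ℤ.- j ∣ , ≡.trans (≡.cong (λ z → i ℤ.+ z) (ℤ.∣-∣-≤ i≤j)) (lemma i j)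
    where
    lemma : ∀ i j → i ℤ.+ (j ℤ.- i) ≡ j
    lemma = solve-∀

  i≤∣i∣ : ∀ i → i ℤ.≤ + ∣ i ∣
  i≤∣i∣ (+ n) = ℤ.≤-refl
  i≤∣i∣ -[1+ n ] = ℤ.-≤+

  -∣i∣≤i : ∀ i → ℤ.- + ∣ i ∣ ℤ.≤ i
  -∣i∣≤i i = ≡.subst₂ ℤ._≤_ (≡.cong (λ n → ℤ.- + n) (ℤ.∣-i∣≡∣i∣ i)) (ℤ.neg-involutive i)
    (ℤ.neg-mono-≤ (i≤∣i∣ (ℤ.- i)))

  ≤⇒≤∣∣ : ∀ {k i} → + k ℤ.≤ i → k ℕ.≤ ∣ i ∣
  ≤⇒≤∣∣ {k} {i} k≤i = ℤ.drop‿+≤+ (ℤ.≤-trans k≤i (i≤∣i∣ i))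

  ≤-⇒≤∣∣ : ∀ {k i} → i ℤ.≤ ℤ.- + k → k ℕ.≤ ∣ i ∣
  ≤-⇒≤∣∣ {k} {i} i≤-k = ≡.subst (k ℕ.≤_) (ℤ.∣-i∣≡∣i∣ i)
    (≤⇒≤∣∣ (≡.subst (ℤ._≤ ℤ.- i) (ℤ.neg-involutive (+ k)) (ℤ.neg-mono-≤ i≤-k)))

module Bilateral {c ℓ} (R : CommutativeSemiring c ℓ) where
  open CommutativeSemiring R hiding (zero)
  open import Algebra.Properties.CommutativeSemigroup +-commutativeSemigroup using (interchange)
  open import Relation.Binary.Reasoning.Setoid setoid

  ∑ : ℤ → ℕ → (ℤ → Carrier) → Carrier
  ∑ s zero f = 0#
  ∑ s (suc n) f = f s + ∑ (ℤ.suc s) n f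

  ∑-cong : ∀ s n {f g} → (∀ i → f i ≈ g i) → ∑ s n f ≈ ∑ s n g
  ∑-cong s zero f≈g = refl
  ∑-cong s (suc n) f≈g = +-cong (f≈g s) (∑-cong (ℤ.suc s) n f≈g)

  ∑-+ : ∀ s n f g → ∑ s n (λ i → f i + g i) ≈ ∑ s n f + ∑ s n g
  ∑-+ s zero f g = sym (+-identityˡ 0#)
  ∑-+ s (suc n) f g = trans (+-congˡ (∑-+ (ℤ.suc s) n f g)) (interchange _ _ _ _)

  ∑-*ˡ : ∀ s n x f → ∑ s n (λ i → x * f i) ≈ x * ∑ s n f
  ∑-*ˡ s zero x f = sym (zeroʳ x)
  ∑-*ˡ s (suc n) x f = trans (+-congˡ (∑-*ˡ (ℤ.suc s) n x f)) (sym (distribˡ x _ _))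

  ∑-*ʳ : ∀ s n x f → ∑ s n (λ i → f i * x) ≈ ∑ s n f * x
  ∑-*ʳ s n x f = trans (∑-cong s n (λ i → *-comm (f i) x)) (trans (∑-*ˡ s n x f) (*-comm x _))

  ∑-zero : ∀ s n {f} → (∀ i → f i ≈ 0#) → ∑ s n f ≈ 0#
  ∑-zero s zero f≈0 = refl
  ∑-zero s (suc n) f≈0 = trans (+-cong (f≈0 s) (∑-zero (ℤ.suc s) n f≈0)) (+-identityˡ 0#)

  ∑-swap : ∀ s m s′ n (F : ℤ → ℤ → Carrier) →
    ∑ s m (λ i → ∑ s′ n (λ j → F i j)) ≈ ∑ s′ n (λ j → ∑ s m (λ i → F i j))
  ∑-swap s zero s′ n F = sym (∑-zero s′ n (λ _ → refl))
  ∑-swap s (suc m) s′ n F = trans (+-congˡ (∑-swap (ℤ.suc s) m s′ n F)) (sym (∑-+ s′ n _ _))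

  private
    suc-+ : ∀ s n → (1ℤ ℤ.+ s) ℤ.+ n ≡ s ℤ.+ (1ℤ ℤ.+ n)
    suc-+ = solve-∀

    suc-+′ : ∀ s n → (1ℤ ℤ.+ s) ℤ.+ n ≡ (1ℤ ℤ.+ (s ℤ.+ n))
    suc-+′ = solve-∀

  ∑-split : ∀ s m n f → ∑ s (m ℕ.+ n) f ≈ ∑ s m f + ∑ (s ℤ.+ + m) n f
  ∑-split s zero n f rewrite ℤ.+-identityʳ s = sym (+-identityˡ _)
  ∑-split s (suc m) n f = begin
    f s + ∑ (ℤ.suc s) (m ℕ.+ n) f                              ≈⟨ +-congˡ (∑-split (ℤ.suc s) m n f) ⟩
    f s + (∑ (ℤ.suc s) m f + ∑ (ℤ.suc s ℤ.+ + m) n f)          ≈⟨ +-assoc _ _ _ ⟨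
    ∑ s (suc m) f + ∑ (ℤ.suc s ℤ.+ + m) n f                    ≡⟨ ≡.cong (λ z → ∑ s (suc m) f + ∑ z n f) (suc-+ s (+ m)) ⟩
    ∑ s (suc m) f + ∑ (s ℤ.+ + suc m) n f                      ∎

  ∑-shift : ∀ s n c f → ∑ s n (λ i → f (i ℤ.+ c)) ≈ ∑ (s ℤ.+ c) n f
  ∑-shift s zero c f = refl
  ∑-shift s (suc n) c f = +-congˡ (trans (∑-shift (ℤ.suc s) n c f)
    (reflexive (≡.cong (λ z → ∑ z n f) (suc-+′ s c))))

  ∑-reflect : ∀ s n f → ∑ (ℤ.- (s ℤ.+ + n)) n (λ i → f (ℤ.- i)) ≈ ∑ (ℤ.suc s) n f
  ∑-reflect s zero f = refl
  ∑-reflect s (suc n) f = begin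
    ∑ (ℤ.- (s ℤ.+ + suc n)) (suc n) f⁻                       ≡⟨ ≡.cong (λ k → ∑ (ℤ.- (s ℤ.+ + suc n)) k f⁻) (ℕ.+-comm 1 n) ⟩
    ∑ (ℤ.- (s ℤ.+ + suc n)) (n ℕ.+ 1) f⁻                     ≈⟨ ∑-split _ n 1 f⁻ ⟩
    ∑ (ℤ.- (s ℤ.+ + suc n)) n f⁻ + (f⁻ (ℤ.- (s ℤ.+ + suc n) ℤ.+ + n) + 0#)
      ≈⟨ +-cong (reflexive (≡.cong (λ z → ∑ z n f⁻) (lemma₁ s (+ n)))) (trans (+-identityʳ _) (reflexive (≡.cong f (lemma₂ s (+ n))))) ⟩
    ∑ (ℤ.- (ℤ.suc s ℤ.+ + n)) n f⁻ + f (ℤ.suc s)              ≈⟨ +-congʳ (∑-reflect (ℤ.suc s) n f) ⟩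
    ∑ (ℤ.suc (ℤ.suc s)) n f + f (ℤ.suc s)                     ≈⟨ +-comm _ _ ⟩
    ∑ (ℤ.suc s) (suc n) f                                     ∎
    where
    f⁻ : ℤ → Carrier
    f⁻ i = f (ℤ.- i)
    lemma₁ : ∀ s n → ℤ.- (s ℤ.+ (1ℤ ℤ.+ n)) ≡ ℤ.- ((1ℤ ℤ.+ s) ℤ.+ n)
    lemma₁ = solve-∀
    lemma₂ : ∀ s n → ℤ.- (ℤ.- (s ℤ.+ (1ℤ ℤ.+ n)) ℤ.+ n) ≡ (1ℤ ℤ.+ s)
    lemma₂ = solve-∀

  ∑-parity : ∀ s n f → ∑ (s ℤ.+ s) (n ℕ.+ n) f ≈
    ∑ s n (λ i → f (i ℤ.+ i)) + ∑ s n (λ i → f (ℤ.suc (i ℤ.+ i)))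
  ∑-parity s zero f = sym (+-identityˡ 0#)
  ∑-parity s (suc n) f rewrite ℕ.+-suc n n = begin
    f (s ℤ.+ s) + (f (ℤ.suc (s ℤ.+ s)) + ∑ (ℤ.suc (ℤ.suc (s ℤ.+ s))) (n ℕ.+ n) f)
      ≡⟨ ≡.cong (λ z → f (s ℤ.+ s) + (f (ℤ.suc (s ℤ.+ s)) + ∑ z (n ℕ.+ n) f)) (lemma s) ⟩
    f (s ℤ.+ s) + (f (ℤ.suc (s ℤ.+ s)) + ∑ (ℤ.suc s ℤ.+ ℤ.suc s) (n ℕ.+ n) f)
      ≈⟨ +-assoc _ _ _ ⟨
    f (s ℤ.+ s) + f (ℤ.suc (s ℤ.+ s)) + ∑ (ℤ.suc s ℤ.+ ℤ.suc s) (n ℕ.+ n) f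
      ≈⟨ +-congˡ (∑-parity (ℤ.suc s) n f) ⟩
    f (s ℤ.+ s) + f (ℤ.suc (s ℤ.+ s)) + (∑ (ℤ.suc s) n (λ i → f (i ℤ.+ i)) + ∑ (ℤ.suc s) n (λ i → f (ℤ.suc (i ℤ.+ i))))
      ≈⟨ interchange _ _ _ _ ⟩
    _ ∎
    where
    lemma : ∀ s → (1ℤ ℤ.+ ((1ℤ ℤ.+ (s ℤ.+ s)))) ≡ (1ℤ ℤ.+ s) ℤ.+ (1ℤ ℤ.+ s)
    lemma = solve-∀

  Supported : ℕ → (ℤ → Carrier) → Set ℓ
  Supported K f = ∀ i → K ℕ.≤ ∣ i ∣ → f i ≈ 0#

  private
    ∑-below : ∀ s n u {f} → s ℤ.+ + n ≡ u → (∀ i → i ℤ.≤ u → f i ≈ 0#) → ∑ s n f ≈ 0#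
    ∑-below s zero u eq f≈0 = refl
    ∑-below s (suc n) u ≡.refl f≈0 = trans (+-cong (f≈0 s (ℤ.i≤i+j s (+ suc n))) (∑-below (ℤ.suc s) n u (suc-+ s (+ n)) f≈0)) (+-identityˡ 0#)

    ∑-above : ∀ s n {f} → (∀ i → s ℤ.≤ i → f i ≈ 0#) → ∑ s n f ≈ 0#
    ∑-above s zero f≈0 = refl
    ∑-above s (suc n) f≈0 = trans (+-cong (f≈0 s ℤ.≤-refl) (∑-above (ℤ.suc s) n (λ i le → f≈0 i (ℤ.≤-trans (ℤ.i≤suc[i] s) le)))) (+-identityˡ 0#)

  -- The window [-K, K) is half-open so that doubling it splits exactly into the even numbers 2i and
  -- the odd numbers 2i + 1 with i in the original window.
  ∑ᵂ : ℕ → (ℤ → Carrier) → Carrier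
  ∑ᵂ K f = ∑ (ℤ.- + K) (K ℕ.+ K) f

  -- The range is cut at -K and K, and the outer pieces vanish. This is what makes a finite sum
  -- behave like a bilateral series, whose value does not depend on the window.
  ∑-cover : ∀ K s n {f} → Supported K f → s ℤ.≤ ℤ.- + K → + K ℤ.≤ s ℤ.+ + n → ∑ s n f ≈ ∑ᵂ K f
  ∑-cover K s n {f} supp lo hi with difference lo | difference hi
  ... | x , s+x≡ | y , K+y≡ = begin
    ∑ s n f                                              ≡⟨ ≡.cong (λ k → ∑ s k f) n≡ ⟩
    ∑ s (x ℕ.+ ((K ℕ.+ K) ℕ.+ y)) f                      ≈⟨ ∑-split s x _ f ⟩
    ∑ s x f + ∑ (s ℤ.+ + x) (K ℕ.+ K ℕ.+ y) f            ≈⟨ +-congʳ (∑-below s x (ℤ.- + K) s+x≡ (λ i le → supp i (≤-⇒≤∣∣ le))) ⟩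
    0# + ∑ (s ℤ.+ + x) (K ℕ.+ K ℕ.+ y) f                 ≈⟨ +-identityˡ _ ⟩
    ∑ (s ℤ.+ + x) (K ℕ.+ K ℕ.+ y) f                      ≡⟨ ≡.cong (λ z → ∑ z (K ℕ.+ K ℕ.+ y) f) s+x≡ ⟩
    ∑ (ℤ.- + K) (K ℕ.+ K ℕ.+ y) f                        ≈⟨ ∑-split (ℤ.- + K) (K ℕ.+ K) y f ⟩
    ∑ᵂ K f + ∑ (ℤ.- + K ℤ.+ + (K ℕ.+ K)) y f             ≡⟨ ≡.cong (λ z → ∑ᵂ K f + ∑ z y f) (lemma₁ (+ K)) ⟩
    ∑ᵂ K f + ∑ (+ K) y f                                 ≈⟨ +-congˡ (∑-above (+ K) y (λ i le → supp i (≤⇒≤∣∣ le))) ⟩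
    ∑ᵂ K f + 0#                                          ≈⟨ +-identityʳ _ ⟩
    ∑ᵂ K f                                               ∎
    where
    lemma₁ : ∀ k → ℤ.- k ℤ.+ (k ℤ.+ k) ≡ k
    lemma₁ = solve-∀
    lemma₂ : ∀ s x k y n → s ℤ.+ n ≡ k ℤ.+ y → s ℤ.+ x ≡ ℤ.- k → n ≡ x ℤ.+ ((k ℤ.+ k) ℤ.+ y)
    lemma₂ s x k y n eq₁ eq₂ = ≡.trans (≡.trans (l₁ s n) (≡.cong (ℤ._- s) eq₁))
      (≡.trans (l₂ s x k y) (≡.trans (≡.cong (λ z → x ℤ.+ ((k ℤ.- z) ℤ.+ y)) eq₂) (l₃ x k y)))
      where
      l₁ : ∀ s n → n ≡ s ℤ.+ n ℤ.- s
      l₁ = solve-∀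
      l₂ : ∀ s x k y → k ℤ.+ y ℤ.- s ≡ x ℤ.+ ((k ℤ.- (s ℤ.+ x)) ℤ.+ y)
      l₂ = solve-∀
      l₃ : ∀ x k y → x ℤ.+ ((k ℤ.- (ℤ.- k)) ℤ.+ y) ≡ x ℤ.+ ((k ℤ.+ k) ℤ.+ y)
      l₃ = solve-∀
    n≡ : n ≡ x ℕ.+ ((K ℕ.+ K) ℕ.+ y)
    n≡ = ℤ.+-injective (lemma₂ s (+ x) (+ K) (+ y) (+ n) (≡.sym K+y≡) s+x≡)

  ∑ᵂ-enlarge : ∀ K V {f} → Supported K f → K ℕ.≤ V → ∑ᵂ V f ≈ ∑ᵂ K f
  ∑ᵂ-enlarge K V supp K≤V = ∑-cover K (ℤ.- + V) (V ℕ.+ V) supp (ℤ.neg-mono-≤ (ℤ.+≤+ K≤V))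
    (≡.subst (+ K ℤ.≤_) (≡.sym (lemma (+ V))) (ℤ.+≤+ K≤V))
    where
    lemma : ∀ k → ℤ.- k ℤ.+ (k ℤ.+ k) ≡ k
    lemma = solve-∀

  -- For |c| ≤ K the moved window still covers [-K, K) because V ≥ 2K. For larger c it may miss the
  -- support, and `big` makes both sides zero. In a double sum c comes from the other index, and the
  -- summand dies once that index is large.
  ∑ᵂ-shift : ∀ K V c {f} → Supported K f → (K ℕ.≤ ∣ c ∣ → ∀ i → f i ≈ 0#) → K ℕ.+ K ℕ.≤ V →
    ∑ᵂ V (λ i → f (i ℤ.+ c)) ≈ ∑ᵂ K f
  ∑ᵂ-shift K V c {f} supp big K+K≤V with K ℕ.≤? ∣ c ∣
  ... | yes K≤∣c∣ = trans (∑-zero (ℤ.- + V) (V ℕ.+ V) (λ i → big K≤∣c∣ _)) (sym (∑-zero (ℤ.- + K) (K ℕ.+ K) (big K≤∣c∣)))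
  ... | no K≰∣c∣ = trans (∑-shift (ℤ.- + V) (V ℕ.+ V) c f)
      (∑-cover K (ℤ.- + V ℤ.+ c) (V ℕ.+ V) supp
        (≡.subst (ℤ.- + V ℤ.+ c ℤ.≤_) (lemma₁ (+ K)) (ℤ.+-mono-≤ (ℤ.neg-mono-≤ V≥) c≤K))
        (≡.subst₂ ℤ._≤_ (lemma₂ (+ K)) (lemma₃ (+ V) c) (ℤ.+-mono-≤ V≥ -K≤c)))
    where
    ∣c∣≤K : + ∣ c ∣ ℤ.≤ + K
    ∣c∣≤K = ℤ.+≤+ (ℕ.<⇒≤ (ℕ.≰⇒> K≰∣c∣))
    c≤K : c ℤ.≤ + K
    c≤K = ℤ.≤-trans (i≤∣i∣ c) ∣c∣≤K
    -K≤c : ℤ.- + K ℤ.≤ c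
    -K≤c = ℤ.≤-trans (ℤ.neg-mono-≤ ∣c∣≤K) (-∣i∣≤i c)
    V≥ : + (K ℕ.+ K) ℤ.≤ + V
    V≥ = ℤ.+≤+ K+K≤V
    lemma₁ : ∀ k → ℤ.- (k ℤ.+ k) ℤ.+ k ≡ ℤ.- k
    lemma₁ = solve-∀
    lemma₂ : ∀ k → (k ℤ.+ k) ℤ.+ ℤ.- k ≡ k
    lemma₂ = solve-∀
    lemma₃ : ∀ v c → v ℤ.+ c ≡ ℤ.- v ℤ.+ c ℤ.+ (v ℤ.+ v)
    lemma₃ = solve-∀

  ∑ᵂ-parity : ∀ V f → ∑ᵂ (V ℕ.+ V) f ≈ ∑ᵂ V (λ i → f (i ℤ.+ i)) + ∑ᵂ V (λ i → f (ℤ.suc (i ℤ.+ i)))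
  ∑ᵂ-parity V f = trans (reflexive (≡.cong (λ z → ∑ z (V ℕ.+ V ℕ.+ (V ℕ.+ V)) f) (ℤ.neg-distrib-+ (+ V) (+ V))))
    (∑-parity (ℤ.- + V) (V ℕ.+ V) f)

-- Products of theta series

private
  ∣i+i∣ : ∀ i → ∣ i ℤ.+ i ∣ ≡ ∣ i ∣ ℕ.+ ∣ i ∣
  ∣i+i∣ (+ n) = ≡.refl
  ∣i+i∣ -[1+ n ] = ≡.cong suc (≡.sym (ℕ.+-suc n n))

  ∣i∣≤∣i+j∣+∣j∣ : ∀ i j → ∣ i ∣ ℕ.≤ ∣ i ℤ.+ j ∣ ℕ.+ ∣ j ∣
  ∣i∣≤∣i+j∣+∣j∣ i j = ≡.subst (λ z → ∣ z ∣ ℕ.≤ ∣ i ℤ.+ j ∣ ℕ.+ ∣ j ∣) (lemma i j) (ℤ.∣i-j∣≤∣i∣+∣j∣ (i ℤ.+ j) j)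
    where
    lemma : ∀ i j → i ℤ.+ j ℤ.- j ≡ i
    lemma = solve-∀

  -- Two indices whose difference is large cannot both lie in the support. The bound is 2K - 1
  -- rather than 2K because the odd difference 2l + 1 has this absolute value at l = -K; the strict
  -- inequality for i makes up for the missing unit.
  far : ∀ {K d i} → K ℕ.+ K ℕ.≤ suc ∣ d ∣ → ∣ i ∣ ℕ.< K → K ℕ.≤ ∣ d ℤ.+ i ∣
  far {K} {d} {i} 2K≤ i<K = ℕ.+-cancelʳ-≤ K K _ (begin
    K ℕ.+ K                              ≤⟨ 2K≤ ⟩
    suc ∣ d ∣                            ≤⟨ ℕ.s≤s (∣i∣≤∣i+j∣+∣j∣ d i) ⟩
    suc (∣ d ℤ.+ i ∣ ℕ.+ ∣ i ∣)          ≡⟨ ℕ.+-suc _ _ ⟨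
    ∣ d ℤ.+ i ∣ ℕ.+ suc ∣ i ∣            ≤⟨ ℕ.+-monoʳ-≤ ∣ d ℤ.+ i ∣ i<K ⟩
    ∣ d ℤ.+ i ∣ ℕ.+ K                    ∎)
    where open ℕ.≤-Reasoning

  far-even : ∀ {K} l → K ℕ.≤ ∣ l ∣ → K ℕ.+ K ℕ.≤ suc ∣ l ℤ.+ l ∣
  far-even l K≤ = ℕ.m≤n⇒m≤1+n (≡.subst (_ ℕ.≤_) (≡.sym (∣i+i∣ l)) (ℕ.+-mono-≤ K≤ K≤))

  far-odd : ∀ {K} l → K ℕ.≤ ∣ l ∣ → K ℕ.+ K ℕ.≤ suc ∣ ℤ.suc (l ℤ.+ l) ∣
  far-odd {K} l K≤ = begin
    K ℕ.+ K                              ≤⟨ ℕ.+-mono-≤ K≤ K≤ ⟩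
    ∣ l ∣ ℕ.+ ∣ l ∣                      ≡⟨ ∣i+i∣ l ⟨
    ∣ l ℤ.+ l ∣                          ≤⟨ ∣i∣≤∣i+j∣+∣j∣ (l ℤ.+ l) 1ℤ ⟩
    ∣ l ℤ.+ l ℤ.+ 1ℤ ∣ ℕ.+ 1             ≡⟨ ℕ.+-comm _ 1 ⟩
    suc ∣ l ℤ.+ l ℤ.+ 1ℤ ∣               ≡⟨ ≡.cong (λ z → suc ∣ z ∣) (ℤ.+-comm (l ℤ.+ l) 1ℤ) ⟩
    suc ∣ ℤ.suc (l ℤ.+ l) ∣              ∎
    where open ℕ.≤-Reasoning

module Rotation {c ℓ} (R : CommutativeSemiring c ℓ) where
  open CommutativeSemiring R hiding (zero)
  open Bilateral R
  open import Relation.Binary.Reasoning.Setoid setoid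

  -- The substitution m = k + l, n = k − l when m − n is even, and m = k + l + 1, n = k − l when it is odd.
  ∑ᵂ-rotate : ∀ K V (F : ℤ → ℤ → Carrier) →
    (∀ n → Supported K (λ m → F m n)) → (∀ m → Supported K (F m)) → K ℕ.+ K ℕ.≤ V →
    ∑ᵂ K (λ n → ∑ᵂ K (λ m → F m n)) ≈
      ∑ᵂ V (λ l → ∑ᵂ V (λ k → F (k ℤ.+ l) (k ℤ.- l))) +
      ∑ᵂ V (λ l → ∑ᵂ V (λ k → F (ℤ.suc (k ℤ.+ l)) (k ℤ.- l)))
  ∑ᵂ-rotate K V F supp₁ supp₂ 2K≤V = begin
    ∑ᵂ K (λ n → ∑ᵂ K (λ m → F m n))
      -- The index m is replaced by the difference d = m - n. Its window has size 2V so that the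
      -- parity split leaves l in the window V.
      ≈⟨ ∑-cong _ (K ℕ.+ K) (λ n → sym (∑ᵂ-shift K (V ℕ.+ V) n (supp₁ n) (λ K≤n m → supp₂ m n K≤n) (ℕ.≤-trans 2K≤V (ℕ.m≤m+n V V)))) ⟩
    ∑ᵂ K (λ n → ∑ᵂ (V ℕ.+ V) (λ d → F (d ℤ.+ n) n))
      ≈⟨ ∑ᵂ-enlarge K V (λ n K≤n → ∑-zero _ (V ℕ.+ V ℕ.+ (V ℕ.+ V)) (λ d → supp₂ _ n K≤n)) (ℕ.≤-trans (ℕ.m≤m+n K K) 2K≤V) ⟨
    ∑ᵂ V (λ n → ∑ᵂ (V ℕ.+ V) (λ d → F (d ℤ.+ n) n))
      ≈⟨ ∑-swap _ (V ℕ.+ V) _ (V ℕ.+ V ℕ.+ (V ℕ.+ V)) (λ n d → F (d ℤ.+ n) n) ⟩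
    ∑ᵂ (V ℕ.+ V) (λ d → ∑ᵂ V (λ n → F (d ℤ.+ n) n))
      ≈⟨ ∑ᵂ-parity V _ ⟩
    ∑ᵂ V (λ l → ∑ᵂ V (λ n → F (l ℤ.+ l ℤ.+ n) n)) + ∑ᵂ V (λ l → ∑ᵂ V (λ n → F (ℤ.suc (l ℤ.+ l) ℤ.+ n) n))
      ≈⟨ +-cong (∑-cong _ (V ℕ.+ V) (λ l → recentre l (l ℤ.+ l) (far-even l) (λ k → even k l)))
                (∑-cong _ (V ℕ.+ V) (λ l → recentre l (ℤ.suc (l ℤ.+ l)) (far-odd l) (λ k → odd k l))) ⟩
    _ ∎
    where
    even : ∀ k l → l ℤ.+ l ℤ.+ (k ℤ.- l) ≡ k ℤ.+ l
    even = solve-∀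
    odd : ∀ k l → 1ℤ ℤ.+ (l ℤ.+ l) ℤ.+ (k ℤ.- l) ≡ 1ℤ ℤ.+ (k ℤ.+ l)
    odd = solve-∀
    -- With the difference d fixed, n = k - l turns the pair of indices into (m k, k - l). For |l| ≥
    -- K the difference is so large that every term is zero, which supplies the hypothesis `big` of
    -- the shift.
    recentre : ∀ l d {m : ℤ → ℤ} → (K ℕ.≤ ∣ l ∣ → K ℕ.+ K ℕ.≤ suc ∣ d ∣) → (∀ k → d ℤ.+ (k ℤ.- l) ≡ m k) →
      ∑ᵂ V (λ n → F (d ℤ.+ n) n) ≈ ∑ᵂ V (λ k → F (m k) (k ℤ.- l))
    recentre l d d-far d+k-l≡ = begin
      ∑ᵂ V (λ n → F (d ℤ.+ n) n)
        ≈⟨ ∑ᵂ-enlarge K V (λ n → supp₂ _ n) (ℕ.≤-trans (ℕ.m≤m+n K K) 2K≤V) ⟩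
      ∑ᵂ K (λ n → F (d ℤ.+ n) n)
        ≈⟨ ∑ᵂ-shift K V (ℤ.- l) (λ n → supp₂ _ n) vanish 2K≤V ⟨
      ∑ᵂ V (λ k → F (d ℤ.+ (k ℤ.- l)) (k ℤ.- l))
        ≈⟨ ∑-cong _ (V ℕ.+ V) (λ k → reflexive (≡.cong (λ z → F z (k ℤ.- l)) (d+k-l≡ k))) ⟩
      _ ∎
      where
      vanish : K ℕ.≤ ∣ ℤ.- l ∣ → ∀ i → F (d ℤ.+ i) i ≈ 0#
      vanish K≤l i with K ℕ.≤? ∣ i ∣
      ... | yes K≤i = supp₂ _ i K≤i
      ... | no K≰i = supp₁ i _ (far {d = d} {i = i} (d-far (≡.subst (K ℕ.≤_) (ℤ.∣-i∣≡∣i∣ l) K≤l)) (ℕ.≰⇒> K≰i))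

module Theta {c ℓ} (R : CommutativeSemiring c ℓ) where
  open CommutativeSemiring R hiding (zero)
  open Bilateral R
  open Rotation R
  open import Algebra.Properties.CommutativeSemiring.Exp R using (_^_; ^-congˡ; ^-congʳ; ^-homo-*; ^-assocʳ; ^-distrib-*)
  open import Algebra.Properties.CommutativeSemigroup *-commutativeSemigroup using (interchange)
  open import Relation.Binary.Reasoning.Setoid setoid

  θ-term : Carrier → Carrier → ℤ → Carrier
  θ-term A B i = A ^ t i * B ^ t (ℤ.- i)

  -- Ramanujan's f(A,B), truncated to the window [-K, K).
  θ : ℕ → Carrier → Carrier → Carrier
  θ K A B = ∑ᵂ K (θ-term A B)

  Nilpotent : ℕ → Carrier → Set ℓ
  Nilpotent K x = x ^ K ≈ 0#

  nilpotent-≤ : ∀ {K x n} → Nilpotent K x → K ℕ.≤ n → x ^ n ≈ 0#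
  nilpotent-≤ {K} {x} {n} xᴷ≈0 K≤n = begin
    x ^ n                    ≈⟨ ^-congʳ x (≡.sym (ℕ.m+[n∸m]≡n K≤n)) ⟩
    x ^ (K ℕ.+ (n ℕ.∸ K))    ≈⟨ ^-homo-* x K (n ℕ.∸ K) ⟩
    x ^ K * x ^ (n ℕ.∸ K)    ≈⟨ *-congʳ xᴷ≈0 ⟩
    0# * x ^ (n ℕ.∸ K)       ≈⟨ zeroˡ _ ⟩
    0#                       ∎

  nilpotent-*ˡ : ∀ {K x} y → Nilpotent K x → Nilpotent K (y * x)
  nilpotent-*ˡ {K} {x} y xᴷ≈0 = trans (^-distrib-* y x K) (trans (*-congˡ xᴷ≈0) (zeroʳ _))

  -- For i ≥ 0 the power of A vanishes, for i < 0 the power of B, because in each case the exponent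
  -- is a triangular number at least |i|.
  θ-term-supported : ∀ {K A B} → Nilpotent K A → Nilpotent K B → Supported K (θ-term A B)
  θ-term-supported {K} {A} {B} Aᴷ≈0 Bᴷ≈0 (+ n) K≤n =
    trans (*-congʳ (nilpotent-≤ Aᴷ≈0 (ℕ.≤-trans K≤n (n≤tri n)))) (zeroˡ _)
  θ-term-supported {K} {A} {B} Aᴷ≈0 Bᴷ≈0 -[1+ n ] K≤n =
    trans (*-congˡ (nilpotent-≤ Bᴷ≈0 (ℕ.≤-trans K≤n (n≤tri (suc n))))) (zeroʳ _)

  θ-cong : ∀ K {A A′ B B′} → A ≈ A′ → B ≈ B′ → θ K A B ≈ θ K A′ B′
  θ-cong K A≈ B≈ = ∑-cong _ (K ℕ.+ K) (λ i → *-cong (^-congˡ (t i) A≈) (^-congˡ (t (ℤ.- i)) B≈))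

  -- The reflection i ↦ -i exchanges A and B but turns [-K, K) into (-K, K]. The term at -K is zero
  -- and may be added; then `∑-cover` returns to the original window.
  θ-comm : ∀ {K A B} → Nilpotent K A → Nilpotent K B → θ K A B ≈ θ K B A
  θ-comm {K} {A} {B} Aᴷ≈0 Bᴷ≈0 = begin
    ∑ (ℤ.- + K) (K ℕ.+ K) (θ-term A B)
      ≈⟨ ∑-cong (ℤ.- + K) (K ℕ.+ K) (λ i → trans (*-comm _ _) (*-congˡ (^-congʳ A (≡.cong t (≡.sym (ℤ.neg-involutive i)))))) ⟩
    ∑ (ℤ.- + K) (K ℕ.+ K) (λ i → θ-term B A (ℤ.- i))
      ≡⟨ ≡.cong (λ z → ∑ z (K ℕ.+ K) (λ i → θ-term B A (ℤ.- i))) (lemma₁ (+ K)) ⟩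
    ∑ (ℤ.- (ℤ.- + K ℤ.+ + (K ℕ.+ K))) (K ℕ.+ K) (λ i → θ-term B A (ℤ.- i))
      ≈⟨ ∑-reflect (ℤ.- + K) (K ℕ.+ K) (θ-term B A) ⟩
    ∑ (ℤ.suc (ℤ.- + K)) (K ℕ.+ K) (θ-term B A)
      ≈⟨ +-identityˡ _ ⟨
    0# + ∑ (ℤ.suc (ℤ.- + K)) (K ℕ.+ K) (θ-term B A)
      ≈⟨ +-congʳ (supp (ℤ.- + K) (ℕ.≤-reflexive (≡.sym (ℤ.∣-i∣≡∣i∣ (+ K))))) ⟨
    ∑ (ℤ.- + K) (suc (K ℕ.+ K)) (θ-term B A)
      ≈⟨ ∑-cover K (ℤ.- + K) (suc (K ℕ.+ K)) supp ℤ.≤-refl (≡.subst (+ K ℤ.≤_) (lemma₂ (+ K)) (ℤ.i≤suc[i] (+ K))) ⟩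
    ∑ᵂ K (θ-term B A) ∎
    where
    supp : Supported K (θ-term B A)
    supp = θ-term-supported Bᴷ≈0 Aᴷ≈0
    lemma₁ : ∀ k → ℤ.- k ≡ ℤ.- (ℤ.- k ℤ.+ (k ℤ.+ k))
    lemma₁ = solve-∀
    lemma₂ : ∀ k → 1ℤ ℤ.+ k ≡ ℤ.- k ℤ.+ (1ℤ ℤ.+ (k ℤ.+ k))
    lemma₂ = solve-∀

  module _ (a u v : Carrier) where

    -- Four elements with A B = C D are written as monomials in three free parameters, so that an
    -- identity of theta terms becomes three identities of exponents, one for each parameter.
    mono : ℕ → ℕ → ℕ → Carrier
    mono i j k = a ^ i * (u ^ j * v ^ k)

    mono-* : ∀ i j k i′ j′ k′ → mono i j k * mono i′ j′ k′ ≈ mono (i ℕ.+ i′) (j ℕ.+ j′) (k ℕ.+ k′)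
    mono-* i j k i′ j′ k′ = begin
      mono i j k * mono i′ j′ k′ ≈⟨ interchange _ _ _ _ ⟩
      a ^ i * a ^ i′ * (u ^ j * v ^ k * (u ^ j′ * v ^ k′)) ≈⟨ *-congˡ (interchange _ _ _ _) ⟩
      a ^ i * a ^ i′ * (u ^ j * u ^ j′ * (v ^ k * v ^ k′))
        ≈⟨ *-cong (^-homo-* a i i′) (*-cong (^-homo-* u j j′) (^-homo-* v k k′)) ⟨
      mono (i ℕ.+ i′) (j ℕ.+ j′) (k ℕ.+ k′) ∎

    mono-^ : ∀ i j k n → mono i j k ^ n ≈ mono (i ℕ.* n) (j ℕ.* n) (k ℕ.* n)
    mono-^ i j k n = trans (^-distrib-* _ _ n) (*-cong (^-assocʳ a i n)
      (trans (^-distrib-* _ _ n) (*-cong (^-assocʳ u j n) (^-assocʳ v k n))))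

    mono-cong : ∀ {i j k i′ j′ k′} → + i ≡ + i′ → + j ≡ + j′ → + k ≡ + k′ → mono i j k ≈ mono i′ j′ k′
    mono-cong ≡.refl ≡.refl ≡.refl = refl

    θ-term-mono : ∀ p q r p′ q′ r′ i → let n = t i; n′ = t (ℤ.- i) in
      θ-term (mono p q r) (mono p′ q′ r′) i ≈
        mono (p ℕ.* n ℕ.+ p′ ℕ.* n′) (q ℕ.* n ℕ.+ q′ ℕ.* n′) (r ℕ.* n ℕ.+ r′ ℕ.* n′)
    θ-term-mono p q r p′ q′ r′ i = trans
      (*-cong (mono-^ p q r n) (mono-^ p′ q′ r′ n′)) (mono-* (p ℕ.* n) (q ℕ.* n) (r ℕ.* n) (p′ ℕ.* n′) (q′ ℕ.* n′) (r′ ℕ.* n′))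
      where
      n = t i
      n′ = t (ℤ.- i)

    θ-term-mono-* : ∀ p q r p′ q′ r′ i x y z x′ y′ z′ j → let n = t i; n′ = t (ℤ.- i); m = t j; m′ = t (ℤ.- j) in
      θ-term (mono p q r) (mono p′ q′ r′) i * θ-term (mono x y z) (mono x′ y′ z′) j ≈
        mono (p ℕ.* n ℕ.+ p′ ℕ.* n′ ℕ.+ (x ℕ.* m ℕ.+ x′ ℕ.* m′)) (q ℕ.* n ℕ.+ q′ ℕ.* n′ ℕ.+ (y ℕ.* m ℕ.+ y′ ℕ.* m′))
          (r ℕ.* n ℕ.+ r′ ℕ.* n′ ℕ.+ (z ℕ.* m ℕ.+ z′ ℕ.* m′))
    θ-term-mono-* p q r p′ q′ r′ i x y z x′ y′ z′ j = trans
      (*-cong (θ-term-mono p q r p′ q′ r′ i) (θ-term-mono x y z x′ y′ z′ j))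
      (mono-* (p ℕ.* n ℕ.+ p′ ℕ.* n′) (q ℕ.* n ℕ.+ q′ ℕ.* n′) (r ℕ.* n ℕ.+ r′ ℕ.* n′)
        (x ℕ.* m ℕ.+ x′ ℕ.* m′) (y ℕ.* m ℕ.+ y′ ℕ.* m′) (z ℕ.* m ℕ.+ z′ ℕ.* m′))
      where
      n = t i
      n′ = t (ℤ.- i)
      m = t j
      m′ = t (ℤ.- j)

    private
      Quadruples : Set₁
      Quadruples = (m₊ m₋ n₊ n₋ k₊ k₋ l₊ l₋ : ℤ) → Set

      -- With m and n expressed by k and l, all eight values of `t` are polynomials in k, l, t k and
      -- t l; matching on the equations substitutes them. `e₁` stays free because it alone, besides
      -- m, distinguishes the two parities.
      unify : ∀ (P : Quadruples) m n k l {m₊ m₋ n₊ n₋ k₊ k₋ l₊ l₋ e₁ : ℤ} →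
        m₊ ≡ e₁ → m₋ ≡ m₊ ℤ.- m → l₋ ≡ l₊ ℤ.- l → n₊ ≡ k₊ ℤ.+ l₋ ℤ.+ k ℤ.* (ℤ.- l) → n₋ ≡ n₊ ℤ.- n → k₋ ≡ k₊ ℤ.- k →
        P e₁ (e₁ ℤ.- m) (k₊ ℤ.+ (l₊ ℤ.- l) ℤ.+ k ℤ.* (ℤ.- l)) (k₊ ℤ.+ (l₊ ℤ.- l) ℤ.+ k ℤ.* (ℤ.- l) ℤ.- n)
          k₊ (k₊ ℤ.- k) l₊ (l₊ ℤ.- l) →
        P m₊ m₋ n₊ n₋ k₊ k₋ l₊ l₋
      unify P m n k l ≡.refl ≡.refl ≡.refl ≡.refl ≡.refl ≡.refl p = p

      -- The predicate P is abstract so that Agda does not unfold the products of integers.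
      t-rotate : ∀ (P : Quadruples) k l →
        (∀ x y → P (x ℤ.+ y ℤ.+ k ℤ.* l) (x ℤ.+ y ℤ.+ k ℤ.* l ℤ.- (k ℤ.+ l))
           (x ℤ.+ (y ℤ.- l) ℤ.+ k ℤ.* (ℤ.- l)) (x ℤ.+ (y ℤ.- l) ℤ.+ k ℤ.* (ℤ.- l) ℤ.- (k ℤ.- l))
           x (x ℤ.- k) y (y ℤ.- l)) →
        P (+ t (k ℤ.+ l)) (+ t (ℤ.- (k ℤ.+ l))) (+ t (k ℤ.- l)) (+ t (ℤ.- (k ℤ.- l)))
          (+ t k) (+ t (ℤ.- k)) (+ t l) (+ t (ℤ.- l))
      t-rotate P k l p = unify P (k ℤ.+ l) (k ℤ.- l) k l
        (t-+ k l) (t-neg (k ℤ.+ l)) (t-neg l) (t-+ k (ℤ.- l)) (t-neg (k ℤ.- l)) (t-neg k) (p (+ t k) (+ t l))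

      t-rotate′ : ∀ (P : Quadruples) k l →
        (∀ x y → P (1ℤ ℤ.+ (x ℤ.+ y ℤ.+ k ℤ.* l) ℤ.+ 1ℤ ℤ.* (k ℤ.+ l))
           (1ℤ ℤ.+ (x ℤ.+ y ℤ.+ k ℤ.* l) ℤ.+ 1ℤ ℤ.* (k ℤ.+ l) ℤ.- (1ℤ ℤ.+ (k ℤ.+ l)))
           (x ℤ.+ (y ℤ.- l) ℤ.+ k ℤ.* (ℤ.- l)) (x ℤ.+ (y ℤ.- l) ℤ.+ k ℤ.* (ℤ.- l) ℤ.- (k ℤ.- l))
           x (x ℤ.- k) y (y ℤ.- l)) →
        P (+ t (ℤ.suc (k ℤ.+ l))) (+ t (ℤ.- (ℤ.suc (k ℤ.+ l)))) (+ t (k ℤ.- l)) (+ t (ℤ.- (k ℤ.- l)))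
          (+ t k) (+ t (ℤ.- k)) (+ t l) (+ t (ℤ.- l))
      t-rotate′ P k l p = unify P (ℤ.suc (k ℤ.+ l)) (k ℤ.- l) k l
        (≡.trans (t-+ 1ℤ (k ℤ.+ l)) (≡.cong (λ z → 1ℤ ℤ.+ z ℤ.+ 1ℤ ℤ.* (k ℤ.+ l)) (t-+ k l)))
        (t-neg (ℤ.suc (k ℤ.+ l))) (t-neg l) (t-+ k (ℤ.- l)) (t-neg (k ℤ.- l)) (t-neg k) (p (+ t k) (+ t l))

      -- The summands 0ℤ keep the casts of the exponents definitional, as 1 * n reduces to n + 0 in ℕ.
      term-even : ∀ k l →
        θ-term (mono 1 0 0) (mono 1 1 1) (k ℤ.+ l) * θ-term (mono 1 0 1) (mono 1 1 0) (k ℤ.- l) ≈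
        θ-term (mono 2 0 1) (mono 2 2 1) k * θ-term (mono 2 1 0) (mono 2 1 2) l
      term-even k l = begin
        _ ≈⟨ θ-term-mono-* 1 0 0 1 1 1 (k ℤ.+ l) 1 0 1 1 1 0 (k ℤ.- l) ⟩
        _ ≈⟨ mono-cong
               (t-rotate (λ m m′ n n′ k k′ l l′ → m ℤ.+ 0ℤ ℤ.+ (m′ ℤ.+ 0ℤ) ℤ.+ (n ℤ.+ 0ℤ ℤ.+ (n′ ℤ.+ 0ℤ)) ≡
                   k ℤ.+ (k ℤ.+ 0ℤ) ℤ.+ (k′ ℤ.+ (k′ ℤ.+ 0ℤ)) ℤ.+ (l ℤ.+ (l ℤ.+ 0ℤ) ℤ.+ (l′ ℤ.+ (l′ ℤ.+ 0ℤ)))) k l (eq₁ k l))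
               (t-rotate (λ m m′ n n′ k k′ l l′ → m′ ℤ.+ 0ℤ ℤ.+ (n′ ℤ.+ 0ℤ) ≡
                   k′ ℤ.+ (k′ ℤ.+ 0ℤ) ℤ.+ (l ℤ.+ 0ℤ ℤ.+ (l′ ℤ.+ 0ℤ))) k l (eq₂ k l))
               (t-rotate (λ m m′ n n′ k k′ l l′ → m′ ℤ.+ 0ℤ ℤ.+ (n ℤ.+ 0ℤ ℤ.+ 0ℤ) ≡
                   k ℤ.+ 0ℤ ℤ.+ (k′ ℤ.+ 0ℤ) ℤ.+ (l′ ℤ.+ (l′ ℤ.+ 0ℤ))) k l (eq₃ k l)) ⟩
        _ ≈⟨ θ-term-mono-* 2 0 1 2 2 1 k 2 1 0 2 1 2 l ⟨
        _ ∎
        where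
        eq₁ : ∀ k l x y →
          (x ℤ.+ y ℤ.+ k ℤ.* l) ℤ.+ 0ℤ ℤ.+ (x ℤ.+ y ℤ.+ k ℤ.* l ℤ.- (k ℤ.+ l) ℤ.+ 0ℤ) ℤ.+ (x ℤ.+ (y ℤ.- l) ℤ.+
          k ℤ.* (ℤ.- l) ℤ.+ 0ℤ ℤ.+ (x ℤ.+ (y ℤ.- l) ℤ.+ k ℤ.* (ℤ.- l) ℤ.- (k ℤ.- l) ℤ.+ 0ℤ)) ≡
          x ℤ.+ (x ℤ.+ 0ℤ) ℤ.+ (x ℤ.- k ℤ.+ (x ℤ.- k ℤ.+ 0ℤ)) ℤ.+ (y ℤ.+ (y ℤ.+ 0ℤ) ℤ.+ (y ℤ.- l ℤ.+ (y ℤ.- l ℤ.+ 0ℤ)))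
        eq₁ = solve-∀
        eq₂ : ∀ k l x y →
          x ℤ.+ y ℤ.+ k ℤ.* l ℤ.- (k ℤ.+ l) ℤ.+ 0ℤ ℤ.+ (x ℤ.+ (y ℤ.- l) ℤ.+ k ℤ.* (ℤ.- l) ℤ.- (k ℤ.- l) ℤ.+ 0ℤ) ≡
          x ℤ.- k ℤ.+ (x ℤ.- k ℤ.+ 0ℤ) ℤ.+ (y ℤ.+ 0ℤ ℤ.+ (y ℤ.- l ℤ.+ 0ℤ))
        eq₂ = solve-∀
        eq₃ : ∀ k l x y →
          x ℤ.+ y ℤ.+ k ℤ.* l ℤ.- (k ℤ.+ l) ℤ.+ 0ℤ ℤ.+ (x ℤ.+ (y ℤ.- l) ℤ.+ k ℤ.* (ℤ.- l) ℤ.+ 0ℤ ℤ.+ 0ℤ) ≡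
          x ℤ.+ 0ℤ ℤ.+ (x ℤ.- k ℤ.+ 0ℤ) ℤ.+ (y ℤ.- l ℤ.+ (y ℤ.- l ℤ.+ 0ℤ))
        eq₃ = solve-∀

      -- With m = k + l + 1 and n = k - l the exponent of a is m² + n² = 4 t k + 4 t l + 1. The
      -- constant 1 is the factor in front, and the absence of t (-k) and t (-l) is why the second
      -- arguments on the right contain no a.
      term-odd : ∀ k l →
        θ-term (mono 1 0 0) (mono 1 1 1) (ℤ.suc (k ℤ.+ l)) * θ-term (mono 1 0 1) (mono 1 1 0) (k ℤ.- l) ≈
        mono 1 0 0 * (θ-term (mono 4 1 2) (mono 0 1 0) k * θ-term (mono 4 2 1) (mono 0 0 1) l)
      term-odd k l = begin
        _ ≈⟨ θ-term-mono-* 1 0 0 1 1 1 (ℤ.suc (k ℤ.+ l)) 1 0 1 1 1 0 (k ℤ.- l) ⟩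
        _ ≈⟨ mono-cong
               (t-rotate′ (λ m m′ n n′ k k′ l l′ → m ℤ.+ 0ℤ ℤ.+ (m′ ℤ.+ 0ℤ) ℤ.+ (n ℤ.+ 0ℤ ℤ.+ (n′ ℤ.+ 0ℤ)) ≡
                   1ℤ ℤ.+ (k ℤ.+ (k ℤ.+ (k ℤ.+ (k ℤ.+ 0ℤ))) ℤ.+ 0ℤ ℤ.+ (l ℤ.+ (l ℤ.+ (l ℤ.+ (l ℤ.+ 0ℤ))) ℤ.+ 0ℤ))) k l (eq₁ k l))
               (t-rotate′ (λ m m′ n n′ k k′ l l′ → m′ ℤ.+ 0ℤ ℤ.+ (n′ ℤ.+ 0ℤ) ≡
                   k ℤ.+ 0ℤ ℤ.+ (k′ ℤ.+ 0ℤ) ℤ.+ (l ℤ.+ (l ℤ.+ 0ℤ) ℤ.+ 0ℤ)) k l (eq₂ k l))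
               (t-rotate′ (λ m m′ n n′ k k′ l l′ → m′ ℤ.+ 0ℤ ℤ.+ (n ℤ.+ 0ℤ ℤ.+ 0ℤ) ≡
                   k ℤ.+ (k ℤ.+ 0ℤ) ℤ.+ 0ℤ ℤ.+ (l ℤ.+ 0ℤ ℤ.+ (l′ ℤ.+ 0ℤ))) k l (eq₃ k l)) ⟩
        _ ≈⟨ mono-* 1 0 0 (4 ℕ.* t k ℕ.+ 0 ℕ.+ (4 ℕ.* t l ℕ.+ 0)) (1 ℕ.* t k ℕ.+ 1 ℕ.* t (ℤ.- k) ℕ.+ (2 ℕ.* t l ℕ.+ 0))
               (2 ℕ.* t k ℕ.+ 0 ℕ.+ (1 ℕ.* t l ℕ.+ 1 ℕ.* t (ℤ.- l))) ⟨
        _ ≈⟨ *-congˡ (θ-term-mono-* 4 1 2 0 1 0 k 4 2 1 0 0 1 l) ⟨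
        _ ∎
        where
        eq₁ : ∀ k l x y →
          (1ℤ ℤ.+ (x ℤ.+ y ℤ.+ k ℤ.* l) ℤ.+ 1ℤ ℤ.* (k ℤ.+ l)) ℤ.+ 0ℤ ℤ.+ (((1ℤ ℤ.+ (x ℤ.+ y ℤ.+ k ℤ.* l) ℤ.+ 1ℤ ℤ.* (k ℤ.+
          l)) ℤ.- (1ℤ ℤ.+ (k ℤ.+ l))) ℤ.+ 0ℤ) ℤ.+ ((x ℤ.+ (y ℤ.- l) ℤ.+ k ℤ.* (ℤ.- l)) ℤ.+ 0ℤ ℤ.+ (((x ℤ.+ (y ℤ.- l) ℤ.+
          k ℤ.* (ℤ.- l)) ℤ.- (k ℤ.- l)) ℤ.+ 0ℤ)) ≡
          1ℤ ℤ.+ (x ℤ.+ (x ℤ.+ (x ℤ.+ (x ℤ.+ 0ℤ))) ℤ.+ 0ℤ ℤ.+ (y ℤ.+ (y ℤ.+ (y ℤ.+ (y ℤ.+ 0ℤ))) ℤ.+ 0ℤ))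
        eq₁ = solve-∀
        eq₂ : ∀ k l x y →
          ((1ℤ ℤ.+ (x ℤ.+ y ℤ.+ k ℤ.* l) ℤ.+ 1ℤ ℤ.* (k ℤ.+ l)) ℤ.- (1ℤ ℤ.+ (k ℤ.+ l))) ℤ.+ 0ℤ ℤ.+ (((x ℤ.+ (y ℤ.- l) ℤ.+
          k ℤ.* (ℤ.- l)) ℤ.- (k ℤ.- l)) ℤ.+ 0ℤ) ≡
          x ℤ.+ 0ℤ ℤ.+ ((x ℤ.- k) ℤ.+ 0ℤ) ℤ.+ (y ℤ.+ (y ℤ.+ 0ℤ) ℤ.+ 0ℤ)
        eq₂ = solve-∀
        eq₃ : ∀ k l x y →
          ((1ℤ ℤ.+ (x ℤ.+ y ℤ.+ k ℤ.* l) ℤ.+ 1ℤ ℤ.* (k ℤ.+ l)) ℤ.- (1ℤ ℤ.+ (k ℤ.+ l))) ℤ.+ 0ℤ ℤ.+ ((x ℤ.+ (y ℤ.- l) ℤ.+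
          k ℤ.* (ℤ.- l)) ℤ.+ 0ℤ ℤ.+ 0ℤ) ≡
          x ℤ.+ (x ℤ.+ 0ℤ) ℤ.+ 0ℤ ℤ.+ (y ℤ.+ 0ℤ ℤ.+ ((y ℤ.- l) ℤ.+ 0ℤ))
        eq₃ = solve-∀

    private
      ∑-factor : ∀ V f g → ∑ᵂ V (λ l → ∑ᵂ V (λ k → f k * g l)) ≈ ∑ᵂ V f * ∑ᵂ V g
      ∑-factor V f g = trans (∑-cong _ (V ℕ.+ V) (λ l → ∑-*ʳ _ (V ℕ.+ V) (g l) f)) (∑-*ˡ _ (V ℕ.+ V) _ g)

    -- Ramanujan's f(A,B) f(C,D) for A B = C D, with A = a, B = a u v, C = a v and D = a u.
    θ-product : ∀ K → Nilpotent K a → Nilpotent K u → Nilpotent K v →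
      θ K (mono 1 0 0) (mono 1 1 1) * θ K (mono 1 0 1) (mono 1 1 0) ≈
        θ K (mono 2 0 1) (mono 2 2 1) * θ K (mono 2 1 0) (mono 2 1 2) +
        mono 1 0 0 * (θ K (mono 4 1 2) (mono 0 1 0) * θ K (mono 4 2 1) (mono 0 0 1))
    θ-product K aᴷ≈0 uᴷ≈0 vᴷ≈0 = begin
      ∑ᵂ K w₁ * ∑ᵂ K w₂
        ≈⟨ ∑-factor K w₁ w₂ ⟨
      ∑ᵂ K (λ n → ∑ᵂ K (λ m → w₁ m * w₂ n))
        ≈⟨ ∑ᵂ-rotate K V (λ m n → w₁ m * w₂ n)
             (λ n m K≤m → trans (*-congʳ (θ-term-supported (nil-a 0 0 0) (nil-a 0 1 1) m K≤m)) (zeroˡ _))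
             (λ m n K≤n → trans (*-congˡ (θ-term-supported (nil-a 0 0 1) (nil-a 0 1 0) n K≤n)) (zeroʳ _)) ℕ.≤-refl ⟩
      ∑ᵂ V (λ l → ∑ᵂ V (λ k → w₁ (k ℤ.+ l) * w₂ (k ℤ.- l))) +
      ∑ᵂ V (λ l → ∑ᵂ V (λ k → w₁ (ℤ.suc (k ℤ.+ l)) * w₂ (k ℤ.- l)))
        ≈⟨ +-cong (∑-cong _ (V ℕ.+ V) (λ l → ∑-cong _ (V ℕ.+ V) (λ k → term-even k l)))
                  (trans (∑-cong _ (V ℕ.+ V) (λ l → trans (∑-cong _ (V ℕ.+ V) (λ k → term-odd k l)) (∑-*ˡ _ (V ℕ.+ V) _ _)))
                         (∑-*ˡ _ (V ℕ.+ V) _ _)) ⟩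
      ∑ᵂ V (λ l → ∑ᵂ V (λ k → w₃ k * w₄ l)) + mono 1 0 0 * ∑ᵂ V (λ l → ∑ᵂ V (λ k → w₅ k * w₆ l))
        ≈⟨ +-cong (∑-factor V w₃ w₄) (*-congˡ (∑-factor V w₅ w₆)) ⟩
      ∑ᵂ V w₃ * ∑ᵂ V w₄ + mono 1 0 0 * (∑ᵂ V w₅ * ∑ᵂ V w₆)
        -- All arguments of these series contain a factor a, except the second arguments u and v of
        -- the odd part; nilpotency of all three parameters brings the window back to K.
        ≈⟨ +-cong (*-cong (shrink (nil-a 1 0 1) (nil-a 1 2 1)) (shrink (nil-a 1 1 0) (nil-a 1 1 2)))
                  (*-congˡ (*-cong (shrink (nil-a 3 1 2) nil-u) (shrink (nil-a 3 2 1) nil-v))) ⟩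
      ∑ᵂ K w₃ * ∑ᵂ K w₄ + mono 1 0 0 * (∑ᵂ K w₅ * ∑ᵂ K w₆) ∎
      where
      V : ℕ
      V = K ℕ.+ K
      w₁ w₂ w₃ w₄ w₅ w₆ : ℤ → Carrier
      w₁ = θ-term (mono 1 0 0) (mono 1 1 1)
      w₂ = θ-term (mono 1 0 1) (mono 1 1 0)
      w₃ = θ-term (mono 2 0 1) (mono 2 2 1)
      w₄ = θ-term (mono 2 1 0) (mono 2 1 2)
      w₅ = θ-term (mono 4 1 2) (mono 0 1 0)
      w₆ = θ-term (mono 4 2 1) (mono 0 0 1)
      nil-a : ∀ i j k → Nilpotent K (mono (suc i) j k)
      nil-a i j k = trans (^-congˡ K (trans (*-congʳ (*-comm a _)) (trans (*-assoc _ a _) (trans (*-congˡ (*-comm a _)) (sym (*-assoc _ _ a))))))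
        (nilpotent-*ˡ {K} {a} _ aᴷ≈0)
      nil-u : Nilpotent K (mono 0 1 0)
      nil-u = trans (^-congˡ K (trans (*-identityˡ _) (trans (*-identityʳ _) (*-identityʳ u)))) uᴷ≈0
      nil-v : Nilpotent K (mono 0 0 1)
      nil-v = trans (^-congˡ K (trans (*-identityˡ _) (trans (*-identityˡ _) (*-identityʳ v)))) vᴷ≈0
      shrink : ∀ {A B} → Nilpotent K A → Nilpotent K B → ∑ᵂ V (θ-term A B) ≈ ∑ᵂ K (θ-term A B)
      shrink A B = ∑ᵂ-enlarge K V (θ-term-supported A B) (ℕ.m≤m+n K K)

-- The Jacobi triple product

private
  near-centre : ∀ K i → ∣ + i ℤ.- + (K ℕ.+ K) ∣ ℕ.< K → K ℕ.≤ i
  near-centre K i near = ℕ.+-cancelʳ-≤ K K i (begin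
    K ℕ.+ K                                   ≡⟨ ≡.cong ∣_∣ (lemma (+ i) (+ (K ℕ.+ K))) ⟩
    ∣ + i ℤ.- (+ i ℤ.- + (K ℕ.+ K)) ∣          ≤⟨ ℤ.∣i-j∣≤∣i∣+∣j∣ (+ i) (+ i ℤ.- + (K ℕ.+ K)) ⟩
    i ℕ.+ ∣ + i ℤ.- + (K ℕ.+ K) ∣              ≤⟨ ℕ.+-monoʳ-≤ i (ℕ.<⇒≤ near) ⟩
    i ℕ.+ K                                   ∎)
    where
    open ℕ.≤-Reasoning
    lemma : ∀ i n → n ≡ i ℤ.- (i ℤ.- n)
    lemma = solve-∀

module TripleProduct {c ℓ} (R : CommutativeSemiring c ℓ) where
  open CommutativeSemiring R hiding (zero)
  open Bilateral R
  open Theta R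
  open import Algebra.Properties.CommutativeSemiring.Exp R using (_^_; ^-congˡ; ^-homo-*; ^-distrib-*)
  open import Algebra.Properties.CommutativeSemigroup +-commutativeSemigroup using (interchange)
  open import Algebra.Solver.Ring.NaturalCoefficients.Default R using (solve; _:+_; _:*_; _:=_; con)
  open import Relation.Binary.Reasoning.Setoid setoid

  -- Carrying both indices of the diagonal i + j = n avoids the subtraction n ∸ i and keeps the two
  -- roles of a Gaussian binomial symmetric.
  ∑ᴰ : ℕ → (ℕ → ℕ → Carrier) → Carrier
  ∑ᴰ zero g = g 0 0
  ∑ᴰ (suc n) g = g 0 (suc n) + ∑ᴰ n (λ i j → g (suc i) j)

  ∑ᴰ-cong : ∀ n {g h} → (∀ i j → i ℕ.+ j ≡ n → g i j ≈ h i j) → ∑ᴰ n g ≈ ∑ᴰ n h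
  ∑ᴰ-cong zero g≈h = g≈h 0 0 ≡.refl
  ∑ᴰ-cong (suc n) g≈h = +-cong (g≈h 0 (suc n) ≡.refl) (∑ᴰ-cong n (λ i j eq → g≈h (suc i) j (≡.cong suc eq)))

  ∑ᴰ-+ : ∀ n g h → ∑ᴰ n (λ i j → g i j + h i j) ≈ ∑ᴰ n g + ∑ᴰ n h
  ∑ᴰ-+ zero g h = refl
  ∑ᴰ-+ (suc n) g h = trans (+-congˡ (∑ᴰ-+ n _ _)) (interchange _ _ _ _)

  ∑ᴰ-*ˡ : ∀ n x g → ∑ᴰ n (λ i j → x * g i j) ≈ x * ∑ᴰ n g
  ∑ᴰ-*ˡ zero x g = refl
  ∑ᴰ-*ˡ (suc n) x g = trans (+-congˡ (∑ᴰ-*ˡ n x _)) (sym (distribˡ x _ _))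

  ∑ᴰ-last : ∀ n g → ∑ᴰ (suc n) g ≈ ∑ᴰ n (λ i j → g i (suc j)) + g (suc n) 0
  ∑ᴰ-last zero g = refl
  ∑ᴰ-last (suc n) g = trans (+-congˡ (∑ᴰ-last n (λ i j → g (suc i) j))) (sym (+-assoc _ _ _))

  ∑ᴰ-∑ : ∀ n s f → ∑ᴰ n (λ i j → f (+ i ℤ.+ s)) ≈ ∑ s (suc n) f
  ∑ᴰ-∑ zero s f = trans (reflexive (≡.cong f (ℤ.+-identityˡ s))) (sym (+-identityʳ _))
  ∑ᴰ-∑ (suc n) s f = +-cong (reflexive (≡.cong f (ℤ.+-identityˡ s)))
    (trans (∑ᴰ-cong n (λ i j _ → reflexive (≡.cong f (lemma (+ i) s)))) (∑ᴰ-∑ n (ℤ.suc s) f))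
    where
    lemma : ∀ i s → (1ℤ ℤ.+ i) ℤ.+ s ≡ i ℤ.+ (1ℤ ℤ.+ s)
    lemma = solve-∀

  -- Gaussian binomials and the finite triple product

  module _ (p : Carrier) where

    -- The Gaussian binomial coefficient with entries i + j over i, in base p.
    gauss : ℕ → ℕ → Carrier
    gauss zero j = 1#
    gauss (suc i) zero = 1#
    gauss (suc i) (suc j) = gauss (suc i) j + p ^ suc j * gauss i (suc j)

    -- The second Pascal rule, the mirror image of the defining one under exchange of i and j.
    -- Unfolding one rule by the definition and the other by induction leads to the same expression
    -- on both sides.
    gauss-pascal : ∀ i j → gauss (suc i) (suc j) ≈ gauss i (suc j) + p ^ suc i * gauss (suc i) j
    gauss-pascal zero zero = refl
    gauss-pascal zero (suc j) = begin
      gauss 1 (suc j) + p ^ suc (suc j) * 1#                    ≈⟨ +-congʳ (gauss-pascal zero j) ⟩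
      1# + p ^ 1 * gauss 1 j + p ^ suc (suc j) * 1#
        ≈⟨ solve 3 (λ p g x → con 1 :+ p :* con 1 :* g :+ p :* x :* con 1 := con 1 :+ p :* con 1 :* (g :+ x :* con 1)) refl p (gauss 1 j) (p ^ suc j) ⟩
      1# + p ^ 1 * (gauss 1 j + p ^ suc j * 1#)                 ∎
    gauss-pascal (suc i) zero = begin
      1# + p ^ 1 * gauss (suc i) 1                              ≈⟨ +-congˡ (*-congˡ (gauss-pascal i zero)) ⟩
      1# + p ^ 1 * (gauss i 1 + p ^ suc i * 1#)
        ≈⟨ solve 3 (λ p g x → con 1 :+ p :* con 1 :* (g :+ x :* con 1) := con 1 :+ p :* con 1 :* g :+ p :* x :* con 1) refl p (gauss i 1) (p ^ suc i) ⟩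
      gauss (suc i) 1 + p ^ suc (suc i) * 1#                    ∎
    gauss-pascal (suc i) (suc j) = begin
      gauss (suc (suc i)) (suc j) + p ^ suc (suc j) * gauss (suc i) (suc (suc j))
        ≈⟨ +-cong (gauss-pascal (suc i) j) (*-congˡ (gauss-pascal i (suc j))) ⟩
      gauss (suc i) (suc j) + p ^ suc (suc i) * gauss (suc (suc i)) j + p ^ suc (suc j) * (gauss i (suc (suc j)) + p ^ suc i * gauss (suc i) (suc j))
        ≈⟨ solve 6 (λ g₁ g₂ g₃ p x y → g₁ :+ p :* x :* g₂ :+ p :* y :* (g₃ :+ x :* g₁) := g₁ :+ p :* y :* g₃ :+ p :* x :* (g₂ :+ y :* g₁)) refl
             (gauss (suc i) (suc j)) (gauss (suc (suc i)) j) (gauss i (suc (suc j))) p (p ^ suc i) (p ^ suc j) ⟩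
      gauss (suc i) (suc (suc j)) + p ^ suc (suc i) * gauss (suc (suc i)) (suc j) ∎

    gauss-zeroʳ : ∀ i → gauss i 0 ≡ 1#
    gauss-zeroʳ zero = ≡.refl
    gauss-zeroʳ (suc i) = ≡.refl

    -- Pascal's rule summed along a diagonal. This form absorbs a new factor of `∏ A`; the primed
    -- one, from the second Pascal rule, absorbs a new factor of `∏ B`.
    ∑ᴰ-gauss : ∀ n (h : ℕ → ℕ → Carrier) → ∑ᴰ (suc n) (λ i j → gauss i j * h i j) ≈
      ∑ᴰ n (λ i j → gauss i j * (h i (suc j) + p ^ j * h (suc i) j))
    ∑ᴰ-gauss n h = trans (recursion n) (trans (sym (∑ᴰ-+ n _ _)) (∑ᴰ-cong n (λ i j _ →
        solve 4 (λ g x y p → g :* x :+ p :* g :* y := g :* (x :+ p :* y)) refl (gauss i j) (h i (suc j)) (h (suc i) j) (p ^ j))))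
      where
      recursion : ∀ n → ∑ᴰ (suc n) (λ i j → gauss i j * h i j) ≈
        ∑ᴰ n (λ i j → gauss i j * h i (suc j)) + ∑ᴰ n (λ i j → p ^ j * gauss i j * h (suc i) j)
      recursion zero = +-congˡ (*-congʳ (sym (*-identityˡ 1#)))
      recursion (suc n) = begin
        x + ∑ᴰ (suc n) (λ i j → gauss (suc i) j * h (suc i) j)
          ≈⟨ +-congˡ (∑ᴰ-last n (λ i j → gauss (suc i) j * h (suc i) j)) ⟩
        x + (∑ᴰ n (λ i j → gauss (suc i) (suc j) * h (suc i) (suc j)) + y)
          ≈⟨ +-congˡ (+-congʳ (trans (∑ᴰ-cong n (λ i j _ → distribʳ _ _ _)) (∑ᴰ-+ n _ _))) ⟩
        x + (u + v + y)
          ≈⟨ solve 4 (λ x u v y → x :+ (u :+ v :+ y) := x :+ u :+ (v :+ y)) refl x u v y ⟩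
        x + u + (v + y)
          ≈⟨ +-congˡ (+-congˡ (*-congʳ (trans (sym (*-identityˡ 1#)) (*-congˡ (reflexive (≡.sym (gauss-zeroʳ (suc n)))))))) ⟩
        x + u + (v + p ^ 0 * gauss (suc n) 0 * h (suc (suc n)) 0)
          ≈⟨ +-congˡ (∑ᴰ-last n (λ i j → p ^ j * gauss i j * h (suc i) j)) ⟨
        x + u + ∑ᴰ (suc n) (λ i j → p ^ j * gauss i j * h (suc i) j) ∎
        where
        x y u v : Carrier
        x = gauss 0 (suc (suc n)) * h 0 (suc (suc n))
        y = gauss (suc (suc n)) 0 * h (suc (suc n)) 0
        u = ∑ᴰ n (λ i j → gauss (suc i) j * h (suc i) (suc j))
        v = ∑ᴰ n (λ i j → p ^ suc j * gauss i (suc j) * h (suc i) (suc j))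

    ∑ᴰ-gauss′ : ∀ n (h : ℕ → ℕ → Carrier) → ∑ᴰ (suc n) (λ i j → gauss i j * h i j) ≈
      ∑ᴰ n (λ i j → gauss i j * (h (suc i) j + p ^ i * h i (suc j)))
    ∑ᴰ-gauss′ n h = trans (recursion n) (trans (sym (∑ᴰ-+ n _ _)) (∑ᴰ-cong n (λ i j _ →
        solve 4 (λ g x y p → p :* g :* x :+ g :* y := g :* (y :+ p :* x)) refl (gauss i j) (h i (suc j)) (h (suc i) j) (p ^ i))))
      where
      recursion : ∀ n → ∑ᴰ (suc n) (λ i j → gauss i j * h i j) ≈
        ∑ᴰ n (λ i j → p ^ i * gauss i j * h i (suc j)) + ∑ᴰ n (λ i j → gauss i j * h (suc i) j)
      recursion zero = +-congʳ (*-congʳ (sym (*-identityˡ 1#)))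
      recursion (suc n) = begin
        x + ∑ᴰ (suc n) (λ i j → gauss (suc i) j * h (suc i) j)
          ≈⟨ +-congˡ (∑ᴰ-last n (λ i j → gauss (suc i) j * h (suc i) j)) ⟩
        x + (∑ᴰ n (λ i j → gauss (suc i) (suc j) * h (suc i) (suc j)) + y)
          ≈⟨ +-congˡ (+-congʳ (trans (∑ᴰ-cong n (λ i j _ → trans (*-congʳ (gauss-pascal i j)) (distribʳ _ _ _))) (∑ᴰ-+ n _ _))) ⟩
        x + (u + v + y)
          ≈⟨ solve 4 (λ x u v y → x :+ (u :+ v :+ y) := x :+ v :+ (u :+ y)) refl x u v y ⟩
        x + v + (u + y)
          ≈⟨ +-cong (+-congʳ (*-congʳ (sym (*-identityˡ 1#)))) (+-congˡ (*-congʳ (reflexive (≡.sym (gauss-zeroʳ (suc n)))))) ⟩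
        p ^ 0 * 1# * h 0 (suc (suc n)) + v + (u + gauss (suc n) 0 * h (suc (suc n)) 0)
          ≈⟨ +-congˡ (∑ᴰ-last n (λ i j → gauss i j * h (suc i) j)) ⟨
        p ^ 0 * 1# * h 0 (suc (suc n)) + v + ∑ᴰ (suc n) (λ i j → gauss i j * h (suc i) j) ∎
        where
        x y u v : Carrier
        x = gauss 0 (suc (suc n)) * h 0 (suc (suc n))
        y = gauss (suc (suc n)) 0 * h (suc (suc n)) 0
        u = ∑ᴰ n (λ i j → gauss i (suc j) * h (suc i) (suc j))
        v = ∑ᴰ n (λ i j → p ^ suc i * gauss (suc i) j * h (suc i) (suc j))

    -- The shifted factorial (-A; p)_n.
    ∏ : Carrier → ℕ → Carrier
    ∏ A zero = 1#
    ∏ A (suc n) = (1# + A * p ^ n) * ∏ A n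

    module _ {A B : Carrier} (AB≈p : A * B ≈ p) where

      private
        w : ℤ → Carrier
        w = θ-term A B

        p^ : ∀ n → p ^ n ≈ A ^ n * B ^ n
        p^ n = trans (^-congˡ n (sym AB≈p)) (^-distrib-* A B n)

        normalise : ∀ x n i j → A ^ x * p ^ n * (A ^ i * B ^ j) ≈ A ^ (x ℕ.+ n ℕ.+ i) * B ^ (n ℕ.+ j)
        normalise x n i j = begin
          A ^ x * p ^ n * (A ^ i * B ^ j) ≈⟨ *-congʳ (*-congˡ (p^ n)) ⟩
          A ^ x * (A ^ n * B ^ n) * (A ^ i * B ^ j)
            ≈⟨ solve 5 (λ a b c d e → a :* (b :* c) :* (d :* e) := a :* b :* d :* (c :* e)) refl (A ^ x) (A ^ n) (B ^ n) (A ^ i) (B ^ j) ⟩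
          A ^ x * A ^ n * A ^ i * (B ^ n * B ^ j)
            ≈⟨ *-cong (trans (^-homo-* A (x ℕ.+ n) i) (*-congʳ (^-homo-* A x n))) (^-homo-* B n j) ⟨
          A ^ (x ℕ.+ n ℕ.+ i) * B ^ (n ℕ.+ j) ∎

        normalise′ : ∀ x n i j → B ^ x * p ^ n * (A ^ i * B ^ j) ≈ A ^ (n ℕ.+ i) * B ^ (x ℕ.+ n ℕ.+ j)
        normalise′ x n i j = begin
          B ^ x * p ^ n * (A ^ i * B ^ j) ≈⟨ *-congʳ (*-congˡ (p^ n)) ⟩
          B ^ x * (A ^ n * B ^ n) * (A ^ i * B ^ j)
            ≈⟨ solve 5 (λ a b c d e → a :* (b :* c) :* (d :* e) := b :* d :* (a :* c :* e)) refl (B ^ x) (A ^ n) (B ^ n) (A ^ i) (B ^ j) ⟩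
          A ^ n * A ^ i * (B ^ x * B ^ n * B ^ j)
            ≈⟨ *-cong (^-homo-* A n i) (trans (^-homo-* B (x ℕ.+ n) j) (*-congʳ (^-homo-* B x n))) ⟨
          A ^ (n ℕ.+ i) * B ^ (x ℕ.+ n ℕ.+ j) ∎

        powers : ∀ {i j i′ j′} → + i ≡ + i′ → + j ≡ + j′ → A ^ i * B ^ j ≈ A ^ i′ * B ^ j′
        powers ≡.refl ≡.refl = refl

        t-suc : ∀ k → + t (ℤ.suc k) ≡ + t k ℤ.+ k ℤ.+ 1ℤ
        t-suc k = ≡.trans (t-+ 1ℤ k) (lemma (+ t k) k)
          where
          lemma : ∀ x k → 1ℤ ℤ.+ x ℤ.+ 1ℤ ℤ.* k ≡ x ℤ.+ k ℤ.+ 1ℤ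
          lemma = solve-∀

        t-neg-suc : ∀ k → + t (ℤ.- (ℤ.suc k)) ≡ + t k
        t-neg-suc k = ≡.trans (t-neg (ℤ.suc k)) (≡.trans (≡.cong (ℤ._- ℤ.suc k) (t-suc k)) (lemma (+ t k) k))
          where
          lemma : ∀ x k → x ℤ.+ k ℤ.+ 1ℤ ℤ.- (1ℤ ℤ.+ k) ≡ x
          lemma = solve-∀

        -- Formally w (k + 1) = A p^k w k, but k may be negative. Multiplying by p^j with j + k = M
        -- keeps all exponents natural; `w-down` is the same relation read in the other direction.
        w-up : ∀ M j k → + M ≡ + j ℤ.+ k → A * p ^ M * w k ≈ p ^ j * w (ℤ.suc k)
        w-up M j k M≡j+k = begin
          A * p ^ M * w k           ≈⟨ *-congʳ (*-congʳ (*-identityʳ A)) ⟨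
          A ^ 1 * p ^ M * w k       ≈⟨ normalise 1 M (t k) (t (ℤ.- k)) ⟩
          A ^ (1 ℕ.+ M ℕ.+ t k) * B ^ (M ℕ.+ t (ℤ.- k))
            ≈⟨ powers (≡.trans (≡.cong (λ z → 1ℤ ℤ.+ z ℤ.+ + t k) M≡j+k) (≡.trans (lemma₁ (+ j) k (+ t k)) (≡.cong (λ z → + j ℤ.+ z) (≡.sym (t-suc k)))))
                      (≡.trans (≡.cong₂ ℤ._+_ M≡j+k (t-neg k)) (≡.trans (lemma₂ (+ j) k (+ t k)) (≡.cong (λ z → + j ℤ.+ z) (≡.sym (t-neg-suc k))))) ⟩
          A ^ (0 ℕ.+ j ℕ.+ t (ℤ.suc k)) * B ^ (j ℕ.+ t (ℤ.- (ℤ.suc k)))   ≈⟨ normalise 0 j (t (ℤ.suc k)) (t (ℤ.- (ℤ.suc k))) ⟨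
          A ^ 0 * p ^ j * w (ℤ.suc k)  ≈⟨ *-congʳ (*-identityˡ _) ⟩
          p ^ j * w (ℤ.suc k)          ∎
          where
          lemma₁ : ∀ j k x → 1ℤ ℤ.+ (j ℤ.+ k) ℤ.+ x ≡ j ℤ.+ (x ℤ.+ k ℤ.+ 1ℤ)
          lemma₁ = solve-∀
          lemma₂ : ∀ j k x → j ℤ.+ k ℤ.+ (x ℤ.- k) ≡ j ℤ.+ x
          lemma₂ = solve-∀

        w-down : ∀ L i k → + i ≡ ℤ.suc k ℤ.+ + L → B * p ^ L * w (ℤ.suc k) ≈ p ^ i * w k
        w-down L i k i≡k+L = begin
          B * p ^ L * w (ℤ.suc k)     ≈⟨ *-congʳ (*-congʳ (*-identityʳ B)) ⟨
          B ^ 1 * p ^ L * w (ℤ.suc k) ≈⟨ normalise′ 1 L (t (ℤ.suc k)) (t (ℤ.- (ℤ.suc k))) ⟩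
          A ^ (L ℕ.+ t (ℤ.suc k)) * B ^ (1 ℕ.+ L ℕ.+ t (ℤ.- (ℤ.suc k)))
            ≈⟨ powers (≡.trans (≡.cong (λ z → + L ℤ.+ z) (t-suc k)) (≡.trans (lemma₁ (+ L) k (+ t k)) (≡.cong (ℤ._+ + t k) (≡.sym i≡k+L))))
                      (≡.trans (≡.cong (λ z → 1ℤ ℤ.+ + L ℤ.+ z) (t-neg-suc k)) (≡.trans (lemma₂ (+ L) k (+ t k)) (≡.cong₂ ℤ._+_ (≡.sym i≡k+L) (≡.sym (t-neg k))))) ⟩
          A ^ (i ℕ.+ t k) * B ^ (0 ℕ.+ i ℕ.+ t (ℤ.- k))   ≈⟨ normalise′ 0 i (t k) (t (ℤ.- k)) ⟨
          B ^ 0 * p ^ i * w k  ≈⟨ *-congʳ (*-identityˡ _) ⟩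
          p ^ i * w k          ∎
          where
          lemma₁ : ∀ l k x → l ℤ.+ (x ℤ.+ k ℤ.+ 1ℤ) ≡ 1ℤ ℤ.+ k ℤ.+ l ℤ.+ x
          lemma₁ = solve-∀
          lemma₂ : ∀ l k x → 1ℤ ℤ.+ l ℤ.+ x ≡ 1ℤ ℤ.+ k ℤ.+ l ℤ.+ (x ℤ.- k)
          lemma₂ = solve-∀

      -- A form of the q-binomial theorem. A new factor sends each theta term to itself plus a power
      -- of p times its neighbour, which is the combination that Pascal's rule produces. For a
      -- factor of `∏ B` the centre moves from L to L + 1, so the old term becomes the upper one of
      -- the two neighbours.
      finite-triple-product : ∀ M L →
        ∏ A M * ∏ B L ≈ ∑ᴰ (M ℕ.+ L) (λ i j → gauss i j * w (+ i ℤ.- + L))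
      finite-triple-product zero zero = sym (*-congˡ (*-identityˡ 1#))
      finite-triple-product zero (suc L) = begin
        1# * ((1# + B * p ^ L) * ∏ B L)
          ≈⟨ solve 2 (λ x y → con 1 :* (x :* y) := x :* (con 1 :* y)) refl (1# + B * p ^ L) (∏ B L) ⟩
        (1# + B * p ^ L) * (1# * ∏ B L)
          ≈⟨ *-congˡ (finite-triple-product zero L) ⟩
        (1# + B * p ^ L) * ∑ᴰ L (λ i j → gauss i j * w (+ i ℤ.- + L))
          ≈⟨ ∑ᴰ-*ˡ L _ _ ⟨
        ∑ᴰ L (λ i j → (1# + B * p ^ L) * (gauss i j * w (+ i ℤ.- + L)))
          ≈⟨ ∑ᴰ-cong L step ⟩
        ∑ᴰ L (λ i j → gauss i j * (w (+ suc i ℤ.- + suc L) + p ^ i * w (+ i ℤ.- + suc L)))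
          ≈⟨ ∑ᴰ-gauss′ L (λ i j → w (+ i ℤ.- + suc L)) ⟨
        ∑ᴰ (suc L) (λ i j → gauss i j * w (+ i ℤ.- + suc L)) ∎
        where
        lemma₁ : ∀ i l → 1ℤ ℤ.+ (i ℤ.- (1ℤ ℤ.+ l)) ≡ i ℤ.- l
        lemma₁ = solve-∀
        lemma₂ : ∀ i l → i ≡ 1ℤ ℤ.+ (i ℤ.- (1ℤ ℤ.+ l)) ℤ.+ l
        lemma₂ = solve-∀
        lemma₃ : ∀ i l → i ℤ.- l ≡ 1ℤ ℤ.+ i ℤ.- (1ℤ ℤ.+ l)
        lemma₃ = solve-∀
        step : ∀ i j → i ℕ.+ j ≡ L → (1# + B * p ^ L) * (gauss i j * w (+ i ℤ.- + L)) ≈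
          gauss i j * (w (+ suc i ℤ.- + suc L) + p ^ i * w (+ i ℤ.- + suc L))
        step i j _ = begin
          (1# + B * p ^ L) * (gauss i j * w (+ i ℤ.- + L))
            ≈⟨ solve 3 (λ x g w → (con 1 :+ x) :* (g :* w) := g :* (w :+ x :* w)) refl (B * p ^ L) (gauss i j) (w (+ i ℤ.- + L)) ⟩
          gauss i j * (w (+ i ℤ.- + L) + B * p ^ L * w (+ i ℤ.- + L))
            ≈⟨ *-congˡ (+-cong (reflexive (≡.cong w (lemma₃ (+ i) (+ L))))
                 (trans (*-congˡ (reflexive (≡.cong w (≡.sym (lemma₁ (+ i) (+ L)))))) (w-down L i (+ i ℤ.- + suc L) (lemma₂ (+ i) (+ L))))) ⟩
          gauss i j * (w (+ suc i ℤ.- + suc L) + p ^ i * w (+ i ℤ.- + suc L)) ∎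
      finite-triple-product (suc M) L = begin
        (1# + A * p ^ M) * ∏ A M * ∏ B L
          ≈⟨ *-assoc _ _ _ ⟩
        (1# + A * p ^ M) * (∏ A M * ∏ B L)
          ≈⟨ *-congˡ (finite-triple-product M L) ⟩
        (1# + A * p ^ M) * ∑ᴰ (M ℕ.+ L) (λ i j → gauss i j * w (+ i ℤ.- + L))
          ≈⟨ ∑ᴰ-*ˡ (M ℕ.+ L) _ _ ⟨
        ∑ᴰ (M ℕ.+ L) (λ i j → (1# + A * p ^ M) * (gauss i j * w (+ i ℤ.- + L)))
          ≈⟨ ∑ᴰ-cong (M ℕ.+ L) step ⟩
        ∑ᴰ (M ℕ.+ L) (λ i j → gauss i j * (w (+ i ℤ.- + L) + p ^ j * w (+ suc i ℤ.- + L)))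
          ≈⟨ ∑ᴰ-gauss (M ℕ.+ L) (λ i j → w (+ i ℤ.- + L)) ⟨
        ∑ᴰ (suc M ℕ.+ L) (λ i j → gauss i j * w (+ i ℤ.- + L)) ∎
        where
        lemma₁ : ∀ m l → m ≡ m ℤ.+ l ℤ.- l
        lemma₁ = solve-∀
        lemma₂ : ∀ i j l → i ℤ.+ j ℤ.- l ≡ j ℤ.+ (i ℤ.- l)
        lemma₂ = solve-∀
        lemma₃ : ∀ i l → 1ℤ ℤ.+ (i ℤ.- l) ≡ 1ℤ ℤ.+ i ℤ.- l
        lemma₃ = solve-∀
        step : ∀ i j → i ℕ.+ j ≡ M ℕ.+ L → (1# + A * p ^ M) * (gauss i j * w (+ i ℤ.- + L)) ≈
          gauss i j * (w (+ i ℤ.- + L) + p ^ j * w (+ suc i ℤ.- + L))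
        step i j i+j≡ = begin
          (1# + A * p ^ M) * (gauss i j * w (+ i ℤ.- + L))
            ≈⟨ solve 3 (λ x g w → (con 1 :+ x) :* (g :* w) := g :* (w :+ x :* w)) refl (A * p ^ M) (gauss i j) (w (+ i ℤ.- + L)) ⟩
          gauss i j * (w (+ i ℤ.- + L) + A * p ^ M * w (+ i ℤ.- + L))
            ≈⟨ *-congˡ (+-congˡ (trans (w-up M j (+ i ℤ.- + L)
                 (≡.trans (lemma₁ (+ M) (+ L)) (≡.trans (≡.cong (λ n → + n ℤ.- + L) (≡.sym i+j≡)) (lemma₂ (+ i) (+ j) (+ L)))))
                 (*-congˡ (reflexive (≡.cong w (lemma₃ (+ i) (+ L))))))) ⟩
          gauss i j * (w (+ i ℤ.- + L) + p ^ j * w (+ suc i ℤ.- + L)) ∎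

    -- Both are the reciprocal of the product of the 1 − p^i over i ≥ 1.
    gauss-stable : ∀ {K} → Nilpotent (suc K) p → ∀ i j → gauss (i ℕ.+ suc K) (j ℕ.+ suc K) ≈ gauss (suc K) (suc K)
    gauss-stable pᴷ≈0 zero zero = refl
    gauss-stable {K} pᴷ≈0 zero (suc j) = trans
      (trans (+-congˡ (trans (*-congʳ (nilpotent-≤ pᴷ≈0 (ℕ.m≤n+m (suc K) (suc j)))) (zeroˡ _))) (+-identityʳ _))
      (gauss-stable pᴷ≈0 zero j)
    gauss-stable {K} pᴷ≈0 (suc i) j rewrite ℕ.+-suc j K = trans
      (trans (gauss-pascal (i ℕ.+ suc K) (j ℕ.+ K)) (trans (+-congˡ (trans (*-congʳ (nilpotent-≤ pᴷ≈0 (ℕ.m≤n+m (suc K) (suc i)))) (zeroˡ _))) (+-identityʳ _)))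
      (trans (reflexive (≡.cong (gauss (i ℕ.+ suc K)) (≡.sym (ℕ.+-suc j K)))) (gauss-stable pᴷ≈0 i j))

    -- On the diagonal i + j = 2N only positions within K of the centre N contribute. Since N = 2K,
    -- these have i, j ≥ K, where the Gaussian binomial has reached its stable value; this value
    -- depends on neither A nor B and comes out of the sum.
    triple-product : ∀ {A B K} → A * B ≈ p → Nilpotent (suc K) A → Nilpotent (suc K) B →
      let N = suc K ℕ.+ suc K in ∏ A N * ∏ B N ≈ gauss (suc K) (suc K) * θ (suc K) A B
    triple-product {A} {B} {K₁} AB≈p Aᴷ≈0 Bᴷ≈0 = begin
      ∏ A N * ∏ B N
        ≈⟨ finite-triple-product AB≈p N N ⟩
      ∑ᴰ (N ℕ.+ N) (λ i j → gauss i j * w (+ i ℤ.- + N))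
        ≈⟨ ∑ᴰ-cong (N ℕ.+ N) central ⟩
      ∑ᴰ (N ℕ.+ N) (λ i j → gauss K K * w (+ i ℤ.- + N))
        ≈⟨ ∑ᴰ-*ˡ (N ℕ.+ N) (gauss K K) (λ i j → w (+ i ℤ.- + N)) ⟩
      gauss K K * ∑ᴰ (N ℕ.+ N) (λ i j → w (+ i ℤ.- + N))
        ≈⟨ *-congˡ (∑ᴰ-∑ (N ℕ.+ N) (ℤ.- + N) w) ⟩
      gauss K K * ∑ (ℤ.- + N) (suc (N ℕ.+ N)) w
        ≈⟨ *-congˡ (∑-cover K (ℤ.- + N) (suc (N ℕ.+ N)) supp (ℤ.neg-mono-≤ (ℤ.+≤+ (ℕ.m≤m+n K K)))
             (≡.subst (+ K ℤ.≤_) (lemma (+ N)) (ℤ.+≤+ (ℕ.m≤n⇒m≤1+n (ℕ.m≤m+n K K))))) ⟩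
      gauss K K * θ K A B ∎
      where
      K N : ℕ
      K = suc K₁
      N = K ℕ.+ K
      w : ℤ → Carrier
      w = θ-term A B
      supp : Supported K w
      supp = θ-term-supported Aᴷ≈0 Bᴷ≈0
      pᴷ≈0 : Nilpotent K p
      pᴷ≈0 = trans (^-congˡ K (sym AB≈p)) (nilpotent-*ˡ {K} {B} A Bᴷ≈0)
      lemma : ∀ n → 1ℤ ℤ.+ n ≡ ℤ.- n ℤ.+ (1ℤ ℤ.+ (n ℤ.+ n))
      lemma = solve-∀
      central : ∀ i j → i ℕ.+ j ≡ N ℕ.+ N → gauss i j * w (+ i ℤ.- + N) ≈ gauss K K * w (+ i ℤ.- + N)
      central i j i+j≡ with K ℕ.≤? ∣ + i ℤ.- + N ∣
      ... | yes K≤ = trans (trans (*-congˡ (supp (+ i ℤ.- + N) K≤)) (zeroʳ _)) (sym (trans (*-congˡ (supp (+ i ℤ.- + N) K≤)) (zeroʳ _)))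
      ... | no K≰ = *-congʳ (trans (reflexive (≡.sym (≡.cong₂ gauss (ℕ.m∸n+n≡m K≤i) (ℕ.m∸n+n≡m K≤j)))) (gauss-stable pᴷ≈0 (i ℕ.∸ K) (j ℕ.∸ K)))
        where
        near : ∣ + i ℤ.- + N ∣ ℕ.< K
        near = ℕ.≰⇒> K≰
        K≤i : K ℕ.≤ i
        K≤i = near-centre K i near
        reflected : ∣ + i ℤ.- + N ∣ ≡ ∣ + j ℤ.- + N ∣
        reflected = ≡.trans (≡.cong ∣_∣ (≡.trans (lemma₁ (+ i) (+ j) (+ N)) (≡.trans (≡.cong (λ n → + n ℤ.- (+ j ℤ.+ + N)) i+j≡) (lemma₂ (+ j) (+ N)))))
          (ℤ.∣-i∣≡∣i∣ (+ j ℤ.- + N))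
          where
          lemma₁ : ∀ i j n → i ℤ.- n ≡ i ℤ.+ j ℤ.- (j ℤ.+ n)
          lemma₁ = solve-∀
          lemma₂ : ∀ j n → n ℤ.+ n ℤ.- (j ℤ.+ n) ≡ ℤ.- (j ℤ.- n)
          lemma₂ = solve-∀
        K≤j : K ℕ.≤ j
        K≤j = near-centre K j (≡.subst (ℕ._< K) reflected near)

-- The three-term relation modulo 30

module ModThirty {c ℓ} (R : CommutativeSemiring c ℓ) where
  open CommutativeSemiring R hiding (zero)
  open Theta R
  open TripleProduct R
  open import Algebra.Properties.CommutativeSemiring.Exp R using (_^_; ^-congˡ; ^-congʳ; ^-homo-*; ^-assocʳ; ^-distrib-*)
  open import Algebra.Properties.CommutativeSemigroup *-commutativeSemigroup using (interchange)
  open import Algebra.Solver.Ring.NaturalCoefficients.Default R using (solve; _:+_; _:*_; _:=_; con; Polynomial)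
  open import Relation.Binary.Reasoning.Setoid setoid

  module ThreeTerm (ε q : Carrier) (1+ε≈0 : 1# + ε ≈ 0#) (K₁ : ℕ) (qᴷ≈0 : Nilpotent (suc K₁) q) where

    private
      K : ℕ
      K = suc K₁

      p C : Carrier
      p = q ^ 30
      C = gauss p K K

    -- The factors of (q^r; q^30)_∞ after the first 2K are all 1, as q^K vanishes; the length 2K is
    -- the one that `triple-product` uses.
    φ : ℕ → Carrier
    φ r = ∏ p (ε * q ^ r) (K ℕ.+ K)

    [_] : ℕ → Carrier
    [ r ] = φ r * φ (30 ℕ.∸ r)

    ε²≈1 : ε * ε ≈ 1#
    ε²≈1 = begin
      ε * ε                    ≈⟨ +-identityʳ _ ⟨
      ε * ε + 0#               ≈⟨ +-congˡ 1+ε≈0 ⟨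
      ε * ε + (1# + ε)         ≈⟨ solve 1 (λ e → e :* e :+ (con 1 :+ e) := con 1 :+ (con 1 :+ e) :* e) refl ε ⟩
      1# + (1# + ε) * ε        ≈⟨ +-congˡ (trans (*-congʳ 1+ε≈0) (zeroˡ ε)) ⟩
      1# + 0#                  ≈⟨ +-identityʳ 1# ⟩
      1#                       ∎

    private
      nil : ∀ r → Nilpotent K (q ^ suc r)
      nil r = trans (^-congˡ K (*-comm q (q ^ r))) (nilpotent-*ˡ {K} {q} (q ^ r) qᴷ≈0)

      h : ℕ → ℕ → Carrier
      h x y = θ K (q ^ x) (q ^ y)

      θ⁻ : ℕ → ℕ → Carrier
      θ⁻ x y = θ K (ε * q ^ x) (ε * q ^ y)

      -- The sign sits in a = ε q^(α+1) alone. All theta series on the right contain a to an even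
      -- power, so they are unsigned, and a single ε stays in front of the odd part. For [r][s] the
      -- three increased parameters are r, 30 - r - s and s - r; the successors keep the powers of q
      -- nilpotent.
      θ-product-q : ∀ α μ ν → let e = λ i j k → suc α ℕ.* i ℕ.+ (suc μ ℕ.* j ℕ.+ suc ν ℕ.* k) in
        θ⁻ (e 1 0 0) (e 1 1 1) * θ⁻ (e 1 0 1) (e 1 1 0) ≈
          h (e 2 0 1) (e 2 2 1) * h (e 2 1 0) (e 2 1 2) +
          ε * q ^ e 1 0 0 * (h (e 4 1 2) (e 0 1 0) * h (e 4 2 1) (e 0 0 1))
      θ-product-q α μ ν = begin
        _ ≈⟨ *-cong (θ-cong K (odd 0 0) (odd 1 1)) (θ-cong K (odd 0 1) (odd 1 0)) ⟨
        _ ≈⟨ θ-product a u v K (nilpotent-*ˡ {K} {q ^ suc α} ε (nil α)) (nil μ) (nil ν) ⟩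
        _ ≈⟨ +-cong (*-cong (θ-cong K (even 1 0 1) (even 1 2 1)) (θ-cong K (even 1 1 0) (even 1 1 2)))
                    (*-cong (odd 0 0) (*-cong (θ-cong K (even 2 1 2) (even 0 1 0)) (θ-cong K (even 2 2 1) (even 0 0 1)))) ⟩
        _ ∎
        where
        a u v : Carrier
        a = ε * q ^ suc α
        u = q ^ suc μ
        v = q ^ suc ν
        e : ℕ → ℕ → ℕ → ℕ
        e i j k = suc α ℕ.* i ℕ.+ (suc μ ℕ.* j ℕ.+ suc ν ℕ.* k)
        mono-q : ∀ i j k → mono a u v i j k ≈ ε ^ i * q ^ e i j k
        mono-q i j k = begin
          a ^ i * (u ^ j * v ^ k)
            ≈⟨ *-cong (trans (^-distrib-* ε _ i) (*-congˡ (^-assocʳ q (suc α) i)))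
                      (*-cong (^-assocʳ q (suc μ) j) (^-assocʳ q (suc ν) k)) ⟩
          ε ^ i * q ^ (suc α ℕ.* i) * (q ^ (suc μ ℕ.* j) * q ^ (suc ν ℕ.* k))
            ≈⟨ *-assoc _ _ _ ⟩
          ε ^ i * (q ^ (suc α ℕ.* i) * (q ^ (suc μ ℕ.* j) * q ^ (suc ν ℕ.* k)))
            ≈⟨ *-congˡ (trans (^-homo-* q (suc α ℕ.* i) _) (*-congˡ (^-homo-* q (suc μ ℕ.* j) (suc ν ℕ.* k)))) ⟨
          ε ^ i * q ^ e i j k ∎
        ε-even : ∀ n → ε ^ (n ℕ.* 2) ≈ 1#
        ε-even zero = refl
        ε-even (suc n) = trans (sym (*-assoc ε ε _)) (trans (*-cong ε²≈1 (ε-even n)) (*-identityˡ 1#))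
        even : ∀ n j k → mono a u v (n ℕ.* 2) j k ≈ q ^ e (n ℕ.* 2) j k
        even n j k = trans (mono-q (n ℕ.* 2) j k) (trans (*-congʳ (ε-even n)) (*-identityˡ _))
        odd : ∀ j k → mono a u v 1 j k ≈ ε * q ^ e 1 j k
        odd j k = trans (mono-q 1 j k) (*-congʳ (*-identityʳ ε))

      bracket-θ : ∀ a b → suc a ℕ.+ suc b ≡ 30 → φ (suc a) * φ (suc b) ≈ C * θ⁻ (suc a) (suc b)
      bracket-θ a b a+b≡30 = triple-product p {K = K₁} (begin
          ε * q ^ suc a * (ε * q ^ suc b)       ≈⟨ interchange _ _ _ _ ⟩
          ε * ε * (q ^ suc a * q ^ suc b)       ≈⟨ *-cong ε²≈1 (sym (^-homo-* q (suc a) (suc b))) ⟩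
          1# * q ^ (suc a ℕ.+ suc b)            ≈⟨ *-identityˡ _ ⟩
          q ^ (suc a ℕ.+ suc b)                 ≈⟨ ^-congʳ q a+b≡30 ⟩
          p                                     ∎)
        (nilpotent-*ˡ {K} {q ^ suc a} ε (nil a)) (nilpotent-*ˡ {K} {q ^ suc b} ε (nil b))

      h-comm : ∀ x y → h (suc x) (suc y) ≈ h (suc y) (suc x)
      h-comm x y = θ-comm {K} (nil x) (nil y)

      -- Mirrors the recursion of `_^_`, so that the solver's polynomials evaluate to the powers in
      -- the goal.
      pow : ∀ {n} → Polynomial n → ℕ → Polynomial n
      pow x zero = con 1
      pow x (suc n) = x :* pow x n

      -- The matrix has the columns (h₁₃, h₄₃), (q h₄₉, h₁₉), (h₂₃, q^5 h₅₃), (q^6 h₅₉, h₂₉). With ε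
      -- as -1 its minors are, up to sign, the six products below, that of `[5][6]` multiplied by q;
      -- hence the factor q in the relation.
      h₁₃ h₁₉ h₂₃ h₂₉ h₄₃ h₄₉ h₅₃ h₅₉ : Carrier
      h₁₃ = h 13 47
      h₁₉ = h 19 41
      h₂₃ = h 23 37
      h₂₉ = h 29 31
      h₄₃ = h 43 17
      h₄₉ = h 49 11
      h₅₃ = h 53 7
      h₅₉ = h 59 1

      [6][13] : θ⁻ 6 24 * θ⁻ 13 17 ≈ h₁₉ * h₂₃ + ε * q ^ 6 * (h₄₉ * h₅₃)
      [6][13] = θ-product-q 5 10 6

      [6][7] : θ⁻ 6 24 * θ⁻ 7 23 ≈ h₁₃ * h₂₉ + ε * q ^ 6 * (h₄₃ * h₅₉)
      [6][7] = θ-product-q 5 16 0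

      [11][12] : θ⁻ 11 19 * θ⁻ 12 18 ≈ h₂₃ * h₂₉ + ε * q ^ 11 * (h₅₃ * h₅₉)
      [11][12] = θ-product-q 10 6 0

      [1][12] : θ⁻ 1 29 * θ⁻ 12 18 ≈ h₁₃ * h₁₉ + ε * q ^ 1 * (h₄₃ * h₄₉)
      [1][12] = θ-product-q 0 16 10

      [5][6] : θ⁻ 5 25 * θ⁻ 6 24 ≈ h₄₉ * h₂₉ + ε * q ^ 5 * (h₁₉ * h₅₉)
      [5][6] = trans (θ-product-q 4 18 0) (+-cong (*-congʳ (h-comm 10 48)) (*-congˡ (*-congʳ (h-comm 40 18))))

      [5][12] : θ⁻ 5 25 * θ⁻ 12 18 ≈ h₄₃ * h₂₃ + ε * q ^ 5 * (h₁₃ * h₅₃)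
      [5][12] = trans (θ-product-q 4 12 6) (+-cong (*-congʳ (h-comm 16 42)) (*-congˡ (*-congʳ (h-comm 46 12))))

      -- The difference of the two sides is a multiple of 1 + ε, which is added on the left
      -- to leave an identity of commutative semirings.
      θ-relation : θ⁻ 6 24 * θ⁻ 13 17 * (θ⁻ 6 24 * θ⁻ 7 23) ≈
        θ⁻ 11 19 * θ⁻ 12 18 * (θ⁻ 1 29 * θ⁻ 12 18) + q * (θ⁻ 5 25 * θ⁻ 6 24 * (θ⁻ 5 25 * θ⁻ 12 18))
      θ-relation = begin
        _ ≈⟨ *-cong [6][13] [6][7] ⟩
        L ≈⟨ trans (+-congˡ (trans (*-congʳ 1+ε≈0) (zeroˡ X))) (+-identityʳ L) ⟨
        L + (1# + ε) * X
          ≈⟨ solve 10 (λ ε q a b c d e f g i →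
               (a :* b :+ ε :* pow q 6 :* (c :* d)) :* (e :* f :+ ε :* pow q 6 :* (g :* i)) :+
               (con 1 :+ ε) :* (q :* (b :* f :* (g :* c)) :+ ε :* pow q 11 :* (d :* i :* (e :* a))) :=
               (b :* f :+ ε :* pow q 11 :* (d :* i)) :* (e :* a :+ ε :* pow q 1 :* (g :* c)) :+
               q :* ((c :* f :+ ε :* pow q 5 :* (a :* i)) :* (g :* b :+ ε :* pow q 5 :* (e :* d))))
               refl ε q h₁₉ h₂₃ h₄₉ h₅₃ h₁₃ h₂₉ h₄₃ h₅₉ ⟩
        _ ≈⟨ +-cong (*-cong [11][12] [1][12]) (*-congˡ (*-cong [5][6] [5][12])) ⟨
        _ ∎
        where
        L X : Carrier
        L = (h₁₉ * h₂₃ + ε * q ^ 6 * (h₄₉ * h₅₃)) * (h₁₃ * h₂₉ + ε * q ^ 6 * (h₄₃ * h₅₉))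
        -- The cross terms that cancel on the right: each occurs once in the product of `[11][12]`
        -- and `[1][12]` and once, with the opposite sign, in q times that of `[5][6]` and
        -- `[5][12]`.
        X = q * (h₂₃ * h₂₉ * (h₄₃ * h₄₉)) + ε * q ^ 11 * (h₅₃ * h₅₉ * (h₁₃ * h₁₉))

    -- All three terms have degree four in the brackets, so each carries the same factor C^4, and
    -- the relation of theta series only has to be multiplied by it.
    bracket-relation : [ 6 ] * [ 13 ] * ([ 6 ] * [ 7 ]) ≈
      [ 11 ] * [ 12 ] * ([ 1 ] * [ 12 ]) + q * ([ 5 ] * [ 6 ] * ([ 5 ] * [ 12 ]))
    bracket-relation = begin
      _ ≈⟨ *-cong (*-cong b₆ b₁₃) (*-cong b₆ b₇) ⟩
      _ ≈⟨ pull (θ⁻ 6 24) (θ⁻ 13 17) (θ⁻ 6 24) (θ⁻ 7 23) ⟩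
      _ ≈⟨ *-congˡ θ-relation ⟩
      _ ≈⟨ solve 4 (λ c x q y → c :* (x :+ q :* y) := c :* x :+ q :* (c :* y)) refl (C * C * (C * C)) _ q _ ⟩
      _ ≈⟨ +-cong (pull (θ⁻ 11 19) (θ⁻ 12 18) (θ⁻ 1 29) (θ⁻ 12 18)) (*-congˡ (pull (θ⁻ 5 25) (θ⁻ 6 24) (θ⁻ 5 25) (θ⁻ 12 18))) ⟨
      _ ≈⟨ +-cong (*-cong (*-cong b₁₁ b₁₂) (*-cong b₁ b₁₂)) (*-congˡ (*-cong (*-cong b₅ b₆) (*-cong b₅ b₁₂))) ⟨
      _ ∎
      where
      b₁ : [ 1 ] ≈ C * θ⁻ 1 29
      b₁ = bracket-θ 0 28 ≡.refl
      b₅ : [ 5 ] ≈ C * θ⁻ 5 25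
      b₅ = bracket-θ 4 24 ≡.refl
      b₆ : [ 6 ] ≈ C * θ⁻ 6 24
      b₆ = bracket-θ 5 23 ≡.refl
      b₇ : [ 7 ] ≈ C * θ⁻ 7 23
      b₇ = bracket-θ 6 22 ≡.refl
      b₁₁ : [ 11 ] ≈ C * θ⁻ 11 19
      b₁₁ = bracket-θ 10 18 ≡.refl
      b₁₂ : [ 12 ] ≈ C * θ⁻ 12 18
      b₁₂ = bracket-θ 11 17 ≡.refl
      b₁₃ : [ 13 ] ≈ C * θ⁻ 13 17
      b₁₃ = bracket-θ 12 16 ≡.refl
      pull : ∀ w x y z → C * w * (C * x) * (C * y * (C * z)) ≈ C * C * (C * C) * (w * x * (y * z))
      pull w x y z = solve 5 (λ c w x y z → c :* w :* (c :* x) :* (c :* y :* (c :* z)) := c :* c :* (c :* c) :* (w :* x :* (y :* z))) refl C w x y z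

-- Truncated power series

Series : Set
Series = ℕ → ℤ

infixl 6 _⊕_
infixl 7 _⊛_

constant : ℤ → Series
constant c zero = c
constant c (suc n) = 0ℤ

_⊕_ : Series → Series → Series
(f ⊕ g) n = f n ℤ.+ g n

-- The Cauchy product, recursive through f = f 0 + q f′.
_⊛_ : Series → Series → Series
(f ⊛ g) zero = f 0 ℤ.* g 0
(f ⊛ g) (suc n) = f 0 ℤ.* g (suc n) ℤ.+ ((λ k → f (suc k)) ⊛ g) n

X : Series
X zero = 0ℤ
X (suc n) = constant 1ℤ n

⊛-cong : ∀ n {f f′ g g′ : Series} → (∀ k → k ℕ.≤ n → f k ≡ f′ k) → (∀ k → k ℕ.≤ n → g k ≡ g′ k) →
  (f ⊛ g) n ≡ (f′ ⊛ g′) n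
⊛-cong zero f≡ g≡ = ≡.cong₂ ℤ._*_ (f≡ 0 ℕ.z≤n) (g≡ 0 ℕ.z≤n)
⊛-cong (suc n) f≡ g≡ = ≡.cong₂ ℤ._+_ (≡.cong₂ ℤ._*_ (f≡ 0 ℕ.z≤n) (g≡ (suc n) ℕ.≤-refl))
  (⊛-cong n (λ k k≤n → f≡ (suc k) (ℕ.s≤s k≤n)) (λ k k≤n → g≡ k (ℕ.m≤n⇒m≤1+n k≤n)))

⊛-distribʳ : ∀ f g h n → ((f ⊕ g) ⊛ h) n ≡ (f ⊛ h) n ℤ.+ (g ⊛ h) n
⊛-distribʳ f g h zero = ℤ.*-distribʳ-+ (h 0) (f 0) (g 0)
⊛-distribʳ f g h (suc n) = ≡.trans (≡.cong (λ z → (f 0 ℤ.+ g 0) ℤ.* h (suc n) ℤ.+ z) (⊛-distribʳ _ _ h n))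
  (lemma (f 0) (g 0) (h (suc n)) _ _)
  where
  lemma : ∀ a b c x y → (a ℤ.+ b) ℤ.* c ℤ.+ (x ℤ.+ y) ≡ (a ℤ.* c ℤ.+ x) ℤ.+ (b ℤ.* c ℤ.+ y)
  lemma = solve-∀

⊛-scale : ∀ c f g n → ((λ k → c ℤ.* f k) ⊛ g) n ≡ c ℤ.* (f ⊛ g) n
⊛-scale c f g zero = ℤ.*-assoc c (f 0) (g 0)
⊛-scale c f g (suc n) = ≡.trans (≡.cong (λ z → c ℤ.* f 0 ℤ.* g (suc n) ℤ.+ z) (⊛-scale c _ g n))
  (lemma c (f 0) (g (suc n)) _)
  where
  lemma : ∀ c a b x → c ℤ.* a ℤ.* b ℤ.+ c ℤ.* x ≡ c ℤ.* (a ℤ.* b ℤ.+ x)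
  lemma = solve-∀

-- The recursion of `_⊛_` treats its factors unequally; commutativity needs this mirrored version.
⊛-sucʳ : ∀ f g n → (f ⊛ g) (suc n) ≡ f (suc n) ℤ.* g 0 ℤ.+ (f ⊛ (λ k → g (suc k))) n
⊛-sucʳ f g zero = ℤ.+-comm (f 0 ℤ.* g 1) (f 1 ℤ.* g 0)
⊛-sucʳ f g (suc n) = ≡.trans (≡.cong (λ z → f 0 ℤ.* g (suc (suc n)) ℤ.+ z) (⊛-sucʳ (λ k → f (suc k)) g n))
  (lemma (f 0 ℤ.* g (suc (suc n))) (f (suc (suc n)) ℤ.* g 0) _)
  where
  lemma : ∀ x y z → x ℤ.+ (y ℤ.+ z) ≡ y ℤ.+ (x ℤ.+ z)
  lemma = solve-∀

⊛-comm : ∀ f g n → (f ⊛ g) n ≡ (g ⊛ f) n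
⊛-comm f g zero = ℤ.*-comm (f 0) (g 0)
⊛-comm f g (suc n) = ≡.trans (≡.cong₂ ℤ._+_ (ℤ.*-comm (f 0) (g (suc n))) (⊛-comm _ g n)) (≡.sym (⊛-sucʳ g f n))

⊛-assoc : ∀ f g h n → ((f ⊛ g) ⊛ h) n ≡ (f ⊛ (g ⊛ h)) n
⊛-assoc f g h zero = ℤ.*-assoc (f 0) (g 0) (h 0)
⊛-assoc f g h (suc n) = ≡.trans (≡.cong (λ z → f 0 ℤ.* g 0 ℤ.* h (suc n) ℤ.+ z)
    (≡.trans (⊛-distribʳ (λ k → f 0 ℤ.* g (suc k)) _ h n)
      (≡.cong₂ ℤ._+_ (⊛-scale (f 0) (λ k → g (suc k)) h n) (⊛-assoc (λ k → f (suc k)) g h n))))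
  (lemma (f 0) (g 0) (h (suc n)) _ _)
  where
  lemma : ∀ a b c x y → a ℤ.* b ℤ.* c ℤ.+ (a ℤ.* x ℤ.+ y) ≡ a ℤ.* (b ℤ.* c ℤ.+ x) ℤ.+ y
  lemma = solve-∀

⊛-zeroˡ : ∀ g n → ((λ _ → 0ℤ) ⊛ g) n ≡ 0ℤ
⊛-zeroˡ g zero = ≡.refl
⊛-zeroˡ g (suc n) = ≡.trans (ℤ.+-identityˡ _) (⊛-zeroˡ g n)

⊛-constant : ∀ c g n → (constant c ⊛ g) n ≡ c ℤ.* g n
⊛-constant c g zero = ≡.refl
⊛-constant c g (suc n) = ≡.trans (≡.cong (λ z → c ℤ.* g (suc n) ℤ.+ z) (⊛-zeroˡ g n)) (ℤ.+-identityʳ _)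

⊛-identityˡ : ∀ g n → (constant 1ℤ ⊛ g) n ≡ g n
⊛-identityˡ g n = ≡.trans (⊛-constant 1ℤ g n) (ℤ.*-identityˡ (g n))

X⊛-suc : ∀ f n → (X ⊛ f) (suc n) ≡ f n
X⊛-suc f n = ≡.trans (ℤ.+-identityˡ _) (⊛-identityˡ f n)

-- The ring ℤ[[q]]/(q^K). The quotient is taken only in the equality; carrier and operations are
-- those of full power series.
truncated : ℕ → CommutativeSemiring 0ℓ 0ℓ
truncated K = record
  { Carrier = Series
  ; _≈_ = _≈_
  ; _+_ = _⊕_
  ; _*_ = _⊛_
  ; 0# = λ _ → 0ℤ
  ; 1# = constant 1ℤ
  ; isCommutativeSemiring = isCommutativeSemiringˡ (record
    { +-isCommutativeMonoid = record
      { isMonoid = record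
        { isSemigroup = record
          { isMagma = record
            { isEquivalence = isEquivalence
            ; ∙-cong = λ f≈ g≈ k k<K → ≡.cong₂ ℤ._+_ (f≈ k k<K) (g≈ k k<K)
            }
          ; assoc = λ f g h → pointwise λ k → ℤ.+-assoc (f k) (g k) (h k)
          }
        ; identity = (λ f → pointwise λ k → ℤ.+-identityˡ (f k)) , (λ f → pointwise λ k → ℤ.+-identityʳ (f k))
        }
      ; comm = λ f g → pointwise λ k → ℤ.+-comm (f k) (g k)
      }
    ; *-isCommutativeMonoid = record
      { isMonoid = record
        { isSemigroup = record
          { isMagma = record
            { isEquivalence = isEquivalence
            ; ∙-cong = λ f≈ g≈ k k<K → ⊛-cong k (λ j j≤k → f≈ j (ℕ.≤-<-trans j≤k k<K)) (λ j j≤k → g≈ j (ℕ.≤-<-trans j≤k k<K))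
            }
          ; assoc = λ f g h → pointwise (⊛-assoc f g h)
          }
        ; identity = (λ f → pointwise (⊛-identityˡ f)) , (λ f → pointwise λ k → ≡.trans (⊛-comm f _ k) (⊛-identityˡ f k))
        }
      ; comm = λ f g → pointwise (⊛-comm f g)
      }
    ; distribʳ = λ h f g → pointwise (⊛-distribʳ f g h)
    ; zeroˡ = λ g → pointwise (⊛-zeroˡ g)
    })
  }
  where
  _≈_ : Series → Series → Set
  f ≈ g = ∀ k → k ℕ.< K → f k ≡ g k
  pointwise : ∀ {f g : Series} → (∀ k → f k ≡ g k) → f ≈ g
  pointwise f≡g k _ = f≡g k
  isEquivalence : IsEquivalence _≈_
  isEquivalence = record
    { refl = λ _ _ → ≡.refl
    ; sym = λ f≈g k k<K → ≡.sym (f≈g k k<K)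
    ; trans = λ f≈g g≈h k k<K → ≡.trans (f≈g k k<K) (g≈h k k<K)
    }

-- Generating functions of partitions

private
  sum-zero : ∀ n (f : ℕ → ℕ) → (∀ k → f k ≡ 0) → sum (applyUpTo f n) ≡ 0
  sum-zero zero f f≡0 = ≡.refl
  sum-zero (suc n) f f≡0 rewrite f≡0 0 = sum-zero n (f ∘ suc) (f≡0 ∘ suc)

  sum-extend : ∀ m n (f : ℕ → ℕ) → (∀ k → m ℕ.≤ k → f k ≡ 0) → sum (applyUpTo f (m ℕ.+ n)) ≡ sum (applyUpTo f m)
  sum-extend zero n f f≡0 = sum-zero n f (λ k → f≡0 k ℕ.z≤n)
  sum-extend (suc m) n f f≡0 = ≡.cong (λ z → f 0 ℕ.+ z) (sum-extend m n (f ∘ suc) (λ k m≤k → f≡0 (suc k) (ℕ.s≤s m≤k)))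

  sum-cong : ∀ n {f g : ℕ → ℕ} → (∀ k → f k ≡ g k) → sum (applyUpTo f n) ≡ sum (applyUpTo g n)
  sum-cong zero f≡g = ≡.refl
  sum-cong (suc n) f≡g = ≡.cong₂ ℕ._+_ (f≡g 0) (sum-cong n (f≡g ∘ suc))

  ≤ᵇ-+ : ∀ t a b → (t ℕ.+ a ℕ.≤ᵇ t ℕ.+ b) ≡ (a ℕ.≤ᵇ b)
  ≤ᵇ-+ zero a b = ≡.refl
  ≤ᵇ-+ (suc zero) zero b = ≡.refl
  ≤ᵇ-+ (suc zero) (suc a) b = ≡.refl
  ≤ᵇ-+ (suc (suc t)) a b = ≤ᵇ-+ (suc t) a b

  <⇒≤ᵇ-false : ∀ m n → n ℕ.< m → (m ℕ.≤ᵇ n) ≡ false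
  <⇒≤ᵇ-false m n n<m with m ℕ.≤ᵇ n in eq
  ... | false = ≡.refl
  ... | true with ℕ.<⇒≱ n<m (ℕ.≤ᵇ⇒≤ m n (≡.subst T (≡.sym eq) _))
  ...   | ()

  term : ℕ → ℕ → List ℕ → ℕ → ℕ
  term n t ts k = if k ℕ.* t ℕ.≤ᵇ n then countReps (n ℕ.∸ k ℕ.* t) ts else 0

  countReps-∷ : ∀ n t ts → countReps n (t ∷ ts) ≡ sum (applyUpTo (term n t ts) (suc n))
  countReps-∷ n t ts = ≡.cong sum (List.map-upTo (term n t ts) (suc n))

  term-vanishes : ∀ n t ts k → n ℕ.< k ℕ.* t → term n t ts k ≡ 0
  term-vanishes n t ts k n<kt rewrite <⇒≤ᵇ-false (k ℕ.* t) n n<kt = ≡.refl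

countReps-small : ∀ n t ts → n ℕ.< t → countReps n (t ∷ ts) ≡ countReps n ts
countReps-small n t ts n<t = ≡.trans (countReps-∷ n t ts) (≡.trans
  (≡.cong (λ z → countReps n ts ℕ.+ z) (sum-zero n (term n t ts ∘ suc)
    (λ k → term-vanishes n t ts (suc k) (ℕ.<-≤-trans n<t (ℕ.m≤m+n t (k ℕ.* t))))))
  (ℕ.+-identityʳ _))

-- Either the first type is absent, or one copy of it can be removed. The sum over multiplicities
-- keeps its old length after the removal, but multiplicities above m contribute zero since the part
-- is positive.
countReps-large : ∀ m t ts →
  countReps (suc t ℕ.+ m) (suc t ∷ ts) ≡ countReps (suc t ℕ.+ m) ts ℕ.+ countReps m (suc t ∷ ts)
countReps-large m t ts = begin
  countReps (suc t ℕ.+ m) (suc t ∷ ts)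
    ≡⟨ countReps-∷ (suc t ℕ.+ m) (suc t) ts ⟩
  countReps (suc t ℕ.+ m) ts ℕ.+ sum (applyUpTo (term (suc t ℕ.+ m) (suc t) ts ∘ suc) (suc t ℕ.+ m))
    ≡⟨ ≡.cong (λ z → countReps (suc t ℕ.+ m) ts ℕ.+ z) (sum-cong (suc t ℕ.+ m) shifted) ⟩
  countReps (suc t ℕ.+ m) ts ℕ.+ sum (applyUpTo (term m (suc t) ts) (suc t ℕ.+ m))
    ≡⟨ ≡.cong (λ z → countReps (suc t ℕ.+ m) ts ℕ.+ sum (applyUpTo (term m (suc t) ts) (suc z))) (ℕ.+-comm t m) ⟩
  countReps (suc t ℕ.+ m) ts ℕ.+ sum (applyUpTo (term m (suc t) ts) (suc m ℕ.+ t))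
    ≡⟨ ≡.cong (λ z → countReps (suc t ℕ.+ m) ts ℕ.+ z) (sum-extend (suc m) t (term m (suc t) ts)
         (λ k m<k → term-vanishes m (suc t) ts k (ℕ.<-≤-trans m<k (ℕ.m≤m*n k (suc t))))) ⟩
  countReps (suc t ℕ.+ m) ts ℕ.+ sum (applyUpTo (term m (suc t) ts) (suc m))
    ≡⟨ ≡.cong (λ z → countReps (suc t ℕ.+ m) ts ℕ.+ z) (countReps-∷ m (suc t) ts) ⟨
  countReps (suc t ℕ.+ m) ts ℕ.+ countReps m (suc t ∷ ts) ∎
  where
  open ≡.≡-Reasoning
  shifted : ∀ k → term (suc t ℕ.+ m) (suc t) ts (suc k) ≡ term m (suc t) ts k
  shifted k = ≡.cong₂ (λ b n → if b then countReps n ts else 0)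
    (≤ᵇ-+ (suc t) (k ℕ.* suc t) m) (ℕ.[m+n]∸[m+o]≡n∸o (suc t) m (k ℕ.* suc t))

partTypes-suc : ∀ colours n → partTypes colours (suc n) ≡ partTypes colours n ++ replicate (colours (suc n)) (suc n)
partTypes-suc colours n = begin
  concatMap copies (map suc (upTo (suc n)))
    ≡⟨ ≡.cong (concatMap copies ∘ map suc) (List.upTo-∷ʳ n) ⟨
  concatMap copies (map suc (upTo n ∷ʳ n))
    ≡⟨ ≡.cong (concatMap copies) (List.map-++ suc (upTo n) (n ∷ [])) ⟩
  concatMap copies (map suc (upTo n) ∷ʳ suc n)
    ≡⟨ List.concatMap-++ copies (map suc (upTo n)) (suc n ∷ []) ⟩
  partTypes colours n ++ (copies (suc n) ++ [])
    ≡⟨ ≡.cong (partTypes colours n ++_) (List.++-identityʳ (copies (suc n))) ⟩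
  partTypes colours n ++ copies (suc n) ∎
  where
  open ≡.≡-Reasoning
  copies : ℕ → List ℕ
  copies s = replicate (colours s) s

partTypes-positive : ∀ colours n → All (1 ℕ.≤_) (partTypes colours n)
partTypes-positive colours zero = []
partTypes-positive colours (suc n) rewrite partTypes-suc colours n =
  All.++⁺ (partTypes-positive colours n) (All.replicate⁺ (colours (suc n)) (ℕ.s≤s ℕ.z≤n))

Periodic : (ℕ → ℕ) → Set
Periodic colours = ∀ s N → colours (s ℕ.+ N ℕ.* 30) ≡ colours s

private
  residue-periodic : ∀ r s N → ((s ℕ.+ N ℕ.* 30) ≡± r mod30) ≡ (s ≡± r mod30)
  residue-periodic r s N = ≡.cong (λ x → ⌊ x ℕ.≟ r ⌋ ∨ ⌊ x ℕ.≟ 30 ℕ.∸ r ⌋) ([m+kn]%n≡m%n s N 30)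

colours₁-periodic : Periodic colours₁
colours₁-periodic s N rewrite residue-periodic 5 s N | residue-periodic 12 s N | residue-periodic 1 s N | residue-periodic 11 s N = ≡.refl

colours₂-periodic : Periodic colours₂
colours₂-periodic s N rewrite residue-periodic 5 s N | residue-periodic 6 s N | residue-periodic 7 s N | residue-periodic 13 s N = ≡.refl

colours₃-periodic : Periodic colours₃
colours₃-periodic s N
  rewrite residue-periodic 1 s N | residue-periodic 6 s N | residue-periodic 7 s N
    | residue-periodic 11 s N | residue-periodic 12 s N | residue-periodic 13 s N = ≡.refl

genFun : List ℕ → Series
genFun ts n = + countReps n ts

-- Let Dᵢ be the product inverted by Fᵢ. The left side of the relation times b₅² is D₂, its first
-- right term times b₅² is D₁, and D₁ D₂ = b₅⁴ b₆ b₁₂ D₃. So multiplying by b₅² F₁ F₂ gives the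
-- claim.
product-cancel : ∀ {c ℓ} (R : CommutativeSemiring c ℓ) → let open CommutativeSemiring R in
  ∀ {b₁ b₅ b₆ b₇ b₁₁ b₁₂ b₁₃ q F₁ F₂ F₃} →
  b₆ * b₁₃ * (b₆ * b₇) ≈ b₁₁ * b₁₂ * (b₁ * b₁₂) + q * (b₅ * b₆ * (b₅ * b₁₂)) →
  b₁ * b₁₁ * (b₅ * b₅) * (b₁₂ * b₁₂) * F₁ ≈ 1# →
  b₇ * b₁₃ * (b₅ * b₅) * (b₆ * b₆) * F₂ ≈ 1# →
  b₁ * b₆ * b₇ * b₁₁ * b₁₂ * b₁₃ * F₃ ≈ 1# →
  F₁ ≈ F₂ + q * F₃
product-cancel R {b₁} {b₅} {b₆} {b₇} {b₁₁} {b₁₂} {b₁₃} {q} {F₁} {F₂} {F₃} relation DF₁≈1 DF₂≈1 DF₃≈1 = begin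
  F₁
    ≈⟨ *-identityʳ F₁ ⟨
  F₁ * 1#
    ≈⟨ *-congˡ DF₂≈1 ⟨
  F₁ * (b₇ * b₁₃ * (b₅ * b₅) * (b₆ * b₆) * F₂)
    ≈⟨ solve 6 (λ b₅ b₆ b₇ b₁₃ x y → x :* (b₇ :* b₁₃ :* (b₅ :* b₅) :* (b₆ :* b₆) :* y) := b₆ :* b₁₃ :* (b₆ :* b₇) :* (b₅ :* b₅ :* x :* y))
         refl b₅ b₆ b₇ b₁₃ F₁ F₂ ⟩
  b₆ * b₁₃ * (b₆ * b₇) * (b₅ * b₅ * F₁ * F₂)
    ≈⟨ *-congʳ relation ⟩
  (b₁₁ * b₁₂ * (b₁ * b₁₂) + q * (b₅ * b₆ * (b₅ * b₁₂))) * (b₅ * b₅ * F₁ * F₂)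
    ≈⟨ solve 8 (λ b₁ b₅ b₆ b₁₁ b₁₂ q x y →
         (b₁₁ :* b₁₂ :* (b₁ :* b₁₂) :+ q :* (b₅ :* b₆ :* (b₅ :* b₁₂))) :* (b₅ :* b₅ :* x :* y) :=
         b₁ :* b₁₁ :* (b₅ :* b₅) :* (b₁₂ :* b₁₂) :* x :* y :+ q :* (b₅ :* b₅ :* b₅ :* b₅ :* b₆ :* b₁₂ :* x :* y))
         refl b₁ b₅ b₆ b₁₁ b₁₂ q F₁ F₂ ⟩
  b₁ * b₁₁ * (b₅ * b₅) * (b₁₂ * b₁₂) * F₁ * F₂ + q * (b₅ * b₅ * b₅ * b₅ * b₆ * b₁₂ * F₁ * F₂)
    ≈⟨ +-cong (trans (*-congʳ DF₁≈1) (*-identityˡ F₂)) (*-congˡ rest) ⟩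
  F₂ + q * F₃ ∎
  where
  open CommutativeSemiring R
  open import Algebra.Solver.Ring.NaturalCoefficients.Default R using (solve; _:+_; _:*_; _:=_)
  open import Relation.Binary.Reasoning.Setoid setoid
  rest : b₅ * b₅ * b₅ * b₅ * b₆ * b₁₂ * F₁ * F₂ ≈ F₃
  rest = begin
    b₅ * b₅ * b₅ * b₅ * b₆ * b₁₂ * F₁ * F₂
      ≈⟨ *-identityʳ _ ⟨
    b₅ * b₅ * b₅ * b₅ * b₆ * b₁₂ * F₁ * F₂ * 1#
      ≈⟨ *-congˡ DF₃≈1 ⟨
    b₅ * b₅ * b₅ * b₅ * b₆ * b₁₂ * F₁ * F₂ * (b₁ * b₆ * b₇ * b₁₁ * b₁₂ * b₁₃ * F₃)
      ≈⟨ solve 10 (λ b₁ b₅ b₆ b₇ b₁₁ b₁₂ b₁₃ x y z →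
           b₅ :* b₅ :* b₅ :* b₅ :* b₆ :* b₁₂ :* x :* y :* (b₁ :* b₆ :* b₇ :* b₁₁ :* b₁₂ :* b₁₃ :* z) :=
           (b₁ :* b₁₁ :* (b₅ :* b₅) :* (b₁₂ :* b₁₂) :* x) :* (b₇ :* b₁₃ :* (b₅ :* b₅) :* (b₆ :* b₆) :* y) :* z)
           refl b₁ b₅ b₆ b₇ b₁₁ b₁₂ b₁₃ F₁ F₂ F₃ ⟩
    b₁ * b₁₁ * (b₅ * b₅) * (b₁₂ * b₁₂) * F₁ * (b₇ * b₁₃ * (b₅ * b₅) * (b₆ * b₆) * F₂) * F₃
      ≈⟨ *-congʳ (trans (*-cong DF₁≈1 DF₂≈1) (*-identityˡ 1#)) ⟩
    1# * F₃
      ≈⟨ *-identityˡ F₃ ⟩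
    F₃ ∎

-- Generating functions as inverses of truncated products

module Truncated (K₁ : ℕ) where
  private
    K : ℕ
    K = suc K₁

    R : CommutativeSemiring _ _
    R = truncated K

  open CommutativeSemiring R hiding (zero)
  open import Algebra.Properties.CommutativeSemiring.Exp R using (_^_; ^-congʳ; ^-homo-*; ^-assocʳ)
  open import Algebra.Solver.Ring.NaturalCoefficients.Default R using (solve; _:+_; _:*_; _:=_; con)
  open import Relation.Binary.Reasoning.Setoid setoid
  open TripleProduct R using (∏)

  ε : Series
  ε = constant -1ℤ

  1+ε≈0 : 1# + ε ≈ 0#
  1+ε≈0 zero _ = ≡.refl
  1+ε≈0 (suc k) _ = ≡.refl

  X^-small : ∀ t f k → k ℕ.< t → (X ^ t * f) k ≡ 0ℤ
  X^-small (suc t) f zero _ = ≡.refl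
  X^-small (suc t) f (suc k) (ℕ.s≤s k<t) = ≡.trans (⊛-assoc X (X ^ t) f (suc k))
    (≡.trans (X⊛-suc (X ^ t * f) k) (X^-small t f k k<t))

  X^-large : ∀ t f k → (X ^ t * f) (t ℕ.+ k) ≡ f k
  X^-large zero f k = ⊛-identityˡ f k
  X^-large (suc t) f k = ≡.trans (⊛-assoc X (X ^ t) f (suc (t ℕ.+ k)))
    (≡.trans (X⊛-suc (X ^ t * f) (t ℕ.+ k)) (X^-large t f k))

  X^≈0 : ∀ {t} → K ℕ.≤ t → X ^ t ≈ 0#
  X^≈0 {t} K≤t = trans (sym (*-identityʳ (X ^ t))) (λ k k<K → X^-small t 1# k (ℕ.<-≤-trans k<K K≤t))

  factor : ℕ → Series
  factor t = 1# + ε * X ^ t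

  genFun-∷ : ∀ t ts → factor (suc t) * genFun (suc t ∷ ts) ≈ genFun ts
  genFun-∷ t ts = begin
    factor (suc t) * G
      ≈⟨ solve 3 (λ e x g → (con 1 :+ e :* x) :* g := g :+ e :* (x :* g)) refl ε (X ^ suc t) G ⟩
    G + ε * (X ^ suc t * G)
      ≈⟨ +-congʳ recurrence ⟩
    genFun ts + X ^ suc t * G + ε * (X ^ suc t * G)
      ≈⟨ solve 3 (λ e y g → g :+ y :+ e :* y := g :+ (con 1 :+ e) :* y) refl ε (X ^ suc t * G) (genFun ts) ⟩
    genFun ts + (1# + ε) * (X ^ suc t * G)
      ≈⟨ +-congˡ {genFun ts} (trans (*-congʳ 1+ε≈0) (zeroˡ (X ^ suc t * G))) ⟩
    genFun ts + 0#
      ≈⟨ +-identityʳ _ ⟩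
    genFun ts ∎
    where
    G : Series
    G = genFun (suc t ∷ ts)
    recurrence : G ≈ genFun ts + X ^ suc t * G
    recurrence k _ with k ℕ.<? suc t
    ... | yes k<t = ≡.trans (≡.cong +_ (countReps-small k (suc t) ts k<t))
          (≡.sym (≡.trans (≡.cong (λ z → genFun ts k ℤ.+ z) (X^-small (suc t) G k k<t)) (ℤ.+-identityʳ _)))
    ... | no k≮t = ≡.subst (λ k → G k ≡ (genFun ts + X ^ suc t * G) k) (ℕ.m+[n∸m]≡n (ℕ.≮⇒≥ k≮t))
          (≡.trans (≡.cong +_ (countReps-large m t ts))
            (≡.cong (λ z → genFun ts (suc t ℕ.+ m) ℤ.+ z) (≡.sym (X^-large (suc t) G m))))
      where
      m : ℕ
      m = k ℕ.∸ suc t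

  factors : List ℕ → Series
  factors = foldr (λ t x → factor t * x) 1#

  factors-genFun : ∀ ts → All (1 ℕ.≤_) ts → factors ts * genFun ts ≈ 1#
  factors-genFun [] [] = trans (*-identityˡ _) λ { zero _ → ≡.refl ; (suc k) _ → ≡.refl }
  factors-genFun (suc t ∷ ts) (_ ∷ positive) = begin
    factor (suc t) * factors ts * genFun (suc t ∷ ts)
      ≈⟨ solve 3 (λ f p g → f :* p :* g := p :* (f :* g)) refl (factor (suc t)) (factors ts) (genFun (suc t ∷ ts)) ⟩
    factors ts * (factor (suc t) * genFun (suc t ∷ ts))
      ≈⟨ *-congˡ (genFun-∷ t ts) ⟩
    factors ts * genFun ts
      ≈⟨ factors-genFun ts positive ⟩
    1# ∎

  factors-++ : ∀ ts us → factors (ts ++ us) ≈ factors ts * factors us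
  factors-++ [] us = sym (*-identityˡ _)
  factors-++ (t ∷ ts) us = trans (*-congˡ (factors-++ ts us)) (sym (*-assoc _ _ _))

  factors-trivial : ∀ t n → K ℕ.≤ t → factors (replicate n t) ≈ 1#
  factors-trivial t zero K≤t = refl
  factors-trivial t (suc n) K≤t = begin
    (1# + ε * X ^ t) * factors (replicate n t)
      ≈⟨ *-cong (+-congˡ {1#} (trans (*-congˡ (X^≈0 K≤t)) (zeroʳ ε))) (factors-trivial t n K≤t) ⟩
    (1# + 0#) * 1#     ≈⟨ *-identityʳ _ ⟩
    1# + 0#            ≈⟨ +-identityʳ 1# ⟩
    1#                 ∎

  factors-partTypes-stable : ∀ colours j → factors (partTypes colours (j ℕ.+ K₁)) ≈ factors (partTypes colours K₁)
  factors-partTypes-stable colours zero = refl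
  factors-partTypes-stable colours (suc j) = begin
    factors (partTypes colours (suc (j ℕ.+ K₁)))
      ≡⟨ ≡.cong factors (partTypes-suc colours (j ℕ.+ K₁)) ⟩
    factors (partTypes colours (j ℕ.+ K₁) ++ replicate (colours (suc (j ℕ.+ K₁))) (suc (j ℕ.+ K₁)))
      ≈⟨ factors-++ (partTypes colours (j ℕ.+ K₁)) _ ⟩
    factors (partTypes colours (j ℕ.+ K₁)) * factors (replicate (colours (suc (j ℕ.+ K₁))) (suc (j ℕ.+ K₁)))
      ≈⟨ *-cong (factors-partTypes-stable colours j) (factors-trivial _ (colours (suc (j ℕ.+ K₁))) (ℕ.s≤s (ℕ.m≤n+m K₁ j))) ⟩
    factors (partTypes colours K₁) * 1#
      ≈⟨ *-identityʳ _ ⟩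
    factors (partTypes colours K₁) ∎

  -- Uniqueness of inverses: parts of size at least K change the product by factors 1 only, so both
  -- series are inverse to the same element. This replaces a direct comparison of counts over
  -- different lists of parts.
  genFun-partTypes-stable : ∀ colours j → genFun (partTypes colours (j ℕ.+ K₁)) ≈ genFun (partTypes colours K₁)
  genFun-partTypes-stable colours j = begin
    G                          ≈⟨ *-identityʳ G ⟨
    G * 1#                     ≈⟨ *-congˡ (factors-genFun _ (partTypes-positive colours K₁)) ⟨
    G * (D * G′)               ≈⟨ solve 3 (λ g d h → g :* (d :* h) := d :* g :* h) refl G D G′ ⟩
    D * G * G′                 ≈⟨ *-congʳ (*-congʳ (factors-partTypes-stable colours j)) ⟨
    factors (partTypes colours (j ℕ.+ K₁)) * G * G′  ≈⟨ *-congʳ (factors-genFun _ (partTypes-positive colours (j ℕ.+ K₁))) ⟩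
    1# * G′                    ≈⟨ *-identityˡ G′ ⟩
    G′                         ∎
    where
    G G′ D : Series
    G = genFun (partTypes colours (j ℕ.+ K₁))
    G′ = genFun (partTypes colours K₁)
    D = factors (partTypes colours K₁)

  factors-shift : ∀ {colours} → Periodic colours → ∀ N n →
    factors (partTypes colours (n ℕ.+ N ℕ.* 30)) ≈
      factors (map (N ℕ.* 30 ℕ.+_) (partTypes colours n)) * factors (partTypes colours (N ℕ.* 30))
  factors-shift periodic N zero = sym (*-identityˡ _)
  factors-shift {colours} periodic N (suc n) = begin
    factors (partTypes colours (suc (n ℕ.+ x)))
      ≡⟨ ≡.cong factors (partTypes-suc colours (n ℕ.+ x)) ⟩
    factors (partTypes colours (n ℕ.+ x) ++ replicate (colours (suc n ℕ.+ x)) (suc n ℕ.+ x))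
      ≈⟨ factors-++ (partTypes colours (n ℕ.+ x)) _ ⟩
    factors (partTypes colours (n ℕ.+ x)) * factors (replicate (colours (suc n ℕ.+ x)) (suc n ℕ.+ x))
      ≈⟨ *-cong (factors-shift periodic N n) (reflexive (≡.cong factors (≡.cong₂ replicate (periodic (suc n) N) (ℕ.+-comm (suc n) x)))) ⟩
    factors (map (x ℕ.+_) (partTypes colours n)) * factors (partTypes colours x) * factors (replicate (colours (suc n)) (x ℕ.+ suc n))
      ≈⟨ solve 3 (λ a b c → a :* b :* c := a :* c :* b) refl _ _ _ ⟩
    factors (map (x ℕ.+_) (partTypes colours n)) * factors (replicate (colours (suc n)) (x ℕ.+ suc n)) * factors (partTypes colours x)
      ≈⟨ *-congʳ (factors-++ (map (x ℕ.+_) (partTypes colours n)) _) ⟨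
    factors (map (x ℕ.+_) (partTypes colours n) ++ replicate (colours (suc n)) (x ℕ.+ suc n)) * factors (partTypes colours x)
      ≡⟨ ≡.cong (λ ts → factors (map (x ℕ.+_) (partTypes colours n) ++ ts) * factors (partTypes colours x)) (List.map-replicate (x ℕ.+_) (colours (suc n)) (suc n)) ⟨
    factors (map (x ℕ.+_) (partTypes colours n) ++ map (x ℕ.+_) (replicate (colours (suc n)) (suc n))) * factors (partTypes colours x)
      ≡⟨ ≡.cong (λ ts → factors ts * factors (partTypes colours x)) (List.map-++ (x ℕ.+_) (partTypes colours n) _) ⟨
    factors (map (x ℕ.+_) (partTypes colours n ++ replicate (colours (suc n)) (suc n))) * factors (partTypes colours x)
      ≡⟨ ≡.cong (λ ts → factors (map (x ℕ.+_) ts) * factors (partTypes colours x)) (partTypes-suc colours n) ⟨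
    factors (map (x ℕ.+_) (partTypes colours (suc n))) * factors (partTypes colours x) ∎
    where
    x : ℕ
    x = N ℕ.* 30

  -- The same factors grouped by residue class, N of them for each entry of `rs`; `factors` follows
  -- the sizes period by period. `factors-periodic` passes from one grouping to the other, one
  -- period at a time.
  ∏-residues : ℕ → List ℕ → Series
  ∏-residues N = foldr (λ r x → ∏ (X ^ 30) (ε * X ^ r) N * x) 1#

  ∏-residues-zero : ∀ rs → ∏-residues 0 rs ≈ 1#
  ∏-residues-zero [] = refl
  ∏-residues-zero (r ∷ rs) = trans (*-identityˡ _) (∏-residues-zero rs)

  ∏-residues-suc : ∀ N rs → ∏-residues (suc N) rs ≈ factors (map (N ℕ.* 30 ℕ.+_) rs) * ∏-residues N rs
  ∏-residues-suc N [] = sym (*-identityˡ 1#)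
  ∏-residues-suc N (r ∷ rs) = trans
    (*-cong (*-congʳ (+-congˡ {1#} (begin
      ε * X ^ r * (X ^ 30) ^ N      ≈⟨ *-congˡ (^-assocʳ X 30 N) ⟩
      ε * X ^ r * X ^ (30 ℕ.* N)    ≈⟨ *-assoc ε _ _ ⟩
      ε * (X ^ r * X ^ (30 ℕ.* N))  ≈⟨ *-congˡ (^-homo-* X r (30 ℕ.* N)) ⟨
      ε * X ^ (r ℕ.+ 30 ℕ.* N)      ≈⟨ *-congˡ (^-congʳ X (≡.trans (ℕ.+-comm r (30 ℕ.* N)) (≡.cong (ℕ._+ r) (ℕ.*-comm 30 N)))) ⟩
      ε * X ^ (N ℕ.* 30 ℕ.+ r)      ∎))) (∏-residues-suc N rs))
    (solve 4 (λ a b c d → a :* b :* (c :* d) := a :* c :* (b :* d)) refl _ _ _ _)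

  factors-periodic : ∀ {colours} → Periodic colours → ∀ N →
    factors (partTypes colours (N ℕ.* 30)) ≈ ∏-residues N (partTypes colours 30)
  factors-periodic {colours} periodic zero = sym (∏-residues-zero (partTypes colours 30))
  factors-periodic {colours} periodic (suc N) = trans (factors-shift periodic N 30)
    (trans (*-congˡ (factors-periodic periodic N)) (sym (∏-residues-suc N (partTypes colours 30))))

-- The partition count bounds the parts by k itself, while the product identity needs one bound M
-- for all coefficients. Truncating right after q^k makes the two lists of parts indistinguishable.
genFun-coefficient : ∀ colours {M} k → k ≤ M →
  genFun (partTypes colours M) k ≡ + colouredPartitions colours k
genFun-coefficient colours {M} k k≤M = ≡.trans
  (≡.cong (λ M → genFun (partTypes colours M) k) (≡.sym (ℕ.m∸n+n≡m k≤M)))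
  (Truncated.genFun-partTypes-stable k colours (M ∸ k) k ℕ.≤-refl)

-- From the three-term relation to partition counts

module ResidueProducts {c ℓ} (R : CommutativeSemiring c ℓ) (φ : ℕ → CommutativeSemiring.Carrier R) where
  open CommutativeSemiring R
  open import Algebra.Solver.Ring.NaturalCoefficients.Default R using (solve; _:*_; _:=_; con)

  ∏[_] : (ℕ → ℕ) → Carrier
  ∏[ colours ] = foldr (λ r x → φ r * x) 1# (partTypes colours 30)

  b : ℕ → Carrier
  b r = φ r * φ (30 ∸ r)

  -- `partTypes colours₁ 30` computes to 1, 5, 5, 11, 12, 12, 18, 18, 19, 25, 25, 29, so only a
  -- reordering of factors remains; likewise for the other two colourings.
  ∏-colours₁ : b 1 * b 11 * (b 5 * b 5) * (b 12 * b 12) ≈ ∏[ colours₁ ]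
  ∏-colours₁ = solve 8 (λ a b c d e f g h →
    a :* h :* (c :* f) :* (b :* g :* (b :* g)) :* (d :* e :* (d :* e)) :=
    a :* (b :* (b :* (c :* (d :* (d :* (e :* (e :* (f :* (g :* (g :* (h :* con 1))))))))))))
    refl (φ 1) (φ 5) (φ 11) (φ 12) (φ 18) (φ 19) (φ 25) (φ 29)

  ∏-colours₂ : b 7 * b 13 * (b 5 * b 5) * (b 6 * b 6) ≈ ∏[ colours₂ ]
  ∏-colours₂ = solve 8 (λ a b c d e f g h →
    c :* f :* (d :* e) :* (a :* h :* (a :* h)) :* (b :* g :* (b :* g)) :=
    a :* (a :* (b :* (b :* (c :* (d :* (e :* (f :* (g :* (g :* (h :* (h :* con 1))))))))))))
    refl (φ 5) (φ 6) (φ 7) (φ 13) (φ 17) (φ 23) (φ 24) (φ 25)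

  ∏-colours₃ : b 1 * b 6 * b 7 * b 11 * b 12 * b 13 ≈ ∏[ colours₃ ]
  ∏-colours₃ = solve 12 (λ a b c d e f f′ e′ d′ c′ b′ a′ →
    a :* a′ :* (b :* b′) :* (c :* c′) :* (d :* d′) :* (e :* e′) :* (f :* f′) :=
    a :* (b :* (c :* (d :* (e :* (f :* (f′ :* (e′ :* (d′ :* (c′ :* (b′ :* (a′ :* con 1))))))))))))
    refl (φ 1) (φ 6) (φ 7) (φ 11) (φ 12) (φ 13) (φ 17) (φ 18) (φ 19) (φ 23) (φ 24) (φ 29)

  cancel-residues : ∀ {q} F₁ F₂ F₃ →
    b 6 * b 13 * (b 6 * b 7) ≈ b 11 * b 12 * (b 1 * b 12) + q * (b 5 * b 6 * (b 5 * b 12)) →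
    ∏[ colours₁ ] * F₁ ≈ 1# → ∏[ colours₂ ] * F₂ ≈ 1# → ∏[ colours₃ ] * F₃ ≈ 1# →
    F₁ ≈ F₂ + q * F₃
  cancel-residues F₁ F₂ F₃ relation DF₁≈1 DF₂≈1 DF₃≈1 = product-cancel R relation
    (trans (*-congʳ ∏-colours₁) DF₁≈1) (trans (*-congʳ ∏-colours₂) DF₂≈1) (trans (*-congʳ ∏-colours₃) DF₃≈1)

module GeneratingFunctions (n : ℕ) where
  open Truncated n
  open CommutativeSemiring (truncated (suc n)) using (_≈_; _*_; _+_; 1#; *-congʳ; trans; sym)
  open ModThirty.ThreeTerm (truncated (suc n)) ε X 1+ε≈0 n (X^≈0 ℕ.≤-refl)
  open ResidueProducts (truncated (suc n)) φ

  -- N is the number of factors in `φ`. Part sizes up to 30 N fill exactly N periods, so their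
  -- product is the product of the brackets itself.
  N M : ℕ
  N = suc n ℕ.+ suc n
  M = N ℕ.* 30

  n≤M : n ≤ M
  n≤M = ℕ.≤-trans (ℕ.n≤1+n n) (ℕ.≤-trans (ℕ.m≤m+n (suc n) (suc n)) (ℕ.m≤m*n N 30))

  F : (ℕ → ℕ) → Series
  F colours = genFun (partTypes colours M)

  ∏-F : ∀ {colours} → Periodic colours → ∏[ colours ] * F colours ≈ 1#
  ∏-F {colours} periodic = trans (*-congʳ {F colours} (sym (factors-periodic periodic N)))
    (factors-genFun _ (partTypes-positive colours M))

  F-relation : F colours₁ ≈ F colours₂ + X * F colours₃
  F-relation = cancel-residues {X} (F colours₁) (F colours₂) (F colours₃) bracket-relation
    (∏-F colours₁-periodic) (∏-F colours₂-periodic) (∏-F colours₃-periodic)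

coefficient-difference : ∀ (f g h : Series) m → f (suc m) ≡ (g ⊕ X ⊛ h) (suc m) → f (suc m) - g (suc m) ≡ h m
coefficient-difference f g h m eq = ≡.trans (≡.cong (_- g (suc m)) eq)
  (≡.trans (cancel (g (suc m)) _) (X⊛-suc h m))
  where
  cancel : ∀ x y → x ℤ.+ y ℤ.- x ≡ y
  cancel = solve-∀

theorem7p1 : (n : ℕ) → 1 ≤ n → (+ p₁ n) - (+ p₂ n) ≡ + p₃ (n ∸ 1)
theorem7p1 (suc m) _ = ≡.subst₂ (λ x y → x - y ≡ + p₃ m)
  (genFun-coefficient colours₁ {M} (suc m) n≤M) (genFun-coefficient colours₂ {M} (suc m) n≤M)
  (≡.trans (coefficient-difference (F colours₁) (F colours₂) (F colours₃) m (F-relation (suc m) ℕ.≤-refl))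
    (genFun-coefficient colours₃ {M} m (ℕ.≤-trans (ℕ.n≤1+n m) n≤M)))
  -- Modulo q^(m+2) the coefficient at m + 1 is the last one that the relation determines.
  where open GeneratingFunctions (suc m)
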